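{- Let $K\ge1$ and $T\ge0$ be integers, $0<p<1/2$, and let $X_1<X_2<\dots<X_K$ be given real numbers. In the non-adaptive sampling setting for computing $\mathsf{SEARCH}$ from noisy pairwise comparisons, in which the sampling procedure is restricted to taking independent samples from a sequence of distributions $p_1,\dots,p_T$ fixed in advance, $$\inf_{\hat\mu}\ \sup_{X}\ \mathbb{P}\big(\hat\mu\ne\mathsf{SEARCH}(X)\big)\ \ge\ \frac14\exp\left(-\frac{T\cdot D_{\mathsf{KL}}(p\|1-p)}{K}\right),$$ where the supremum is over real $X\notin\{X_1,\dots,X_K\}$ and the infimum is over all non-adaptive algorithms making $T$ queries. Consequently, the number of queries required to recover the true value with probability at least $1-\delta$ is $\Omega\left(\frac{K}{1-H(p)}+\frac{K\log(1/\delta)}{D_{\mathsf{KL}}(p\|1-p)}\right)$; that is, there is a universal constant $c>0$ such that for all $K\ge1$, $p\in(0,1/2)$ and $\delta\in(0,0.49)$, any non-adaptive algorithm making $T$ queries with $\sup_X\mathbb{P}(\hat\mu\ne\mathsf{SEARCH}(X))\le\delta$ satisfies $$T\ \ge\ c\left(\frac{K}{1-H(p)}+\frac{K\log(1/\delta)}{D_{\mathsf{KL}}(p\|1-p)}\right).$$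
   Context: With the convention $X_0=-\infty$, $X_{K+1}=+\infty$, for real $X\notin\{X_1,\dots,X_K\}$ define $\mathsf{SEARCH}(X)=\mathsf{SEARCH}(X;X_1,\dots,X_K)=i$, where $i\in\{0,1,\dots,K\}$ is the index with $X_i<X<X_{i+1}$. The sorted order of $X_1,\dots,X_K$ is known; the position of $X$ is unknown. One query consists of choosing $i\in\{1,\dots,K\}$ and observing a noisy comparison of $X$ with $X_i$: a Bernoulli$(1-p)$ sample if $X>X_i$ and a Bernoulli$(p)$ sample if $X<X_i$, with noise independent across queries. A non-adaptive algorithm $\hat\mu$ with $T$ queries fixes, before any observation, probability distributions $p_1,\dots,p_T$ on $\{1,\dots,K\}$; the index queried in round $t$ is drawn from $p_t$, independently across rounds and of all observations. After $T$ rounds it outputs a (possibly random) value in $\{0,1,\dots,K\}$, also denoted $\hat\mu$, based on all queried indices and observations; the noise level $p$ is known. $\mathbb{P}$ is over the observation noise and the algorithm's randomness when the truth is $X$. Notation: $\log$ is natural; $H(p)=-p\log_2 p-(1-p)\log_2(1-p)$ is the binary entropy in bits; $D_{\mathsf{KL}}(p\|1-p)=(1-2p)\log\frac{1-p}{p}$ is the Kullback–Leibler divergence (in nats) between Bernoulli$(p)$ and Bernoulli$(1-p)$. -}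

module Defs where

open import Algebra.Bundles using (CommutativeRing; Semiring)
open import Algebra.Core using (Op₁; Op₂)
open import Algebra.Structures using (IsCommutativeRing)
import Algebra.Definitions.RawSemiring as RawSemiringDefinitions
open import Data.Bool.Base using (Bool; true; false; if_then_else_)
open import Data.Fin.Base as Fin using (Fin; inject₁; suc; toℕ)
import Data.Fin.Properties as Fin
open import Data.Nat.Base as ℕ using (ℕ; zero; suc; _!)
open import Data.Product.Base using (Σ-syntax; ∃-syntax; _×_; _,_; proj₁; proj₂)
open import Data.Vec.Base using (Vec; []; _∷_; _∷ʳ_; lookup; map)
open import Level using (0ℓ) renaming (suc to lsuc)
open import Relation.Binary.Core using (Rel)
import Relation.Binary.Construct.Add.Extrema.Strict as ExtendedStrict
import Relation.Binary.Construct.StrictToNonStrict as StrictToNonStrict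
open import Relation.Binary.Structures using (IsStrictTotalOrder)
open import Relation.Nullary.Construct.Add.Extrema using (_±; ⊥±; [_]; ⊤±)
open import Relation.Nullary.Decidable.Core using (does)
open import Relation.Nullary.Negation.Core using (¬_)
open import Relation.Unary using (Pred)

-- The real numbers, as a totally ordered field (with trichotomy) in which
-- nonempty sets that are bounded above have least upper bounds.  These axioms
-- determine the field up to unique isomorphism and hold for the classical
-- real line.  Inverses and suprema are total operations whose values outside
-- their usual domains are unspecified.
record CompleteOrderedField : Set (lsuc 0ℓ) where
  infix  9 _⁻¹
  infix  8 -_
  infixl 7 _*_ _/_
  infixl 6 _+_
  infix  4 _≈_ _<_
  field
    Carrier            : Set
    _≈_                : Rel Carrier 0ℓ
    _<_                : Rel Carrier 0ℓ
    _+_                : Op₂ Carrier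
    _*_                : Op₂ Carrier
    -_                 : Op₁ Carrier
    0#                 : Carrier
    1#                 : Carrier
    isCommutativeRing  : IsCommutativeRing _≈_ _+_ _*_ -_ 0# 1#
    isStrictTotalOrder : IsStrictTotalOrder _≈_ _<_
    0<1                : 0# < 1#
    +-monoˡ-<          : ∀ {x y} z → x < y → x + z < y + z
    *-pos              : ∀ {x y} → 0# < x → 0# < y → 0# < x * y
    _⁻¹                : Op₁ Carrier
    ⁻¹-inverseʳ        : ∀ {x} → ¬ (x ≈ 0#) → x * x ⁻¹ ≈ 1#

  open StrictToNonStrict _≈_ _<_ public using (_≤_)

  UpperBound : Pred Carrier 0ℓ → Pred Carrier 0ℓ
  UpperBound P u = ∀ x → P x → x ≤ u

  field
    sup       : Pred Carrier 0ℓ → Carrier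
    sup-upper : ∀ P → (∃[ x ] P x) → (∃[ u ] UpperBound P u) →
                UpperBound P (sup P)
    sup-least : ∀ P → (∃[ x ] P x) → ∀ u → UpperBound P u → sup P ≤ u

  commutativeRing : CommutativeRing 0ℓ 0ℓ
  commutativeRing = record { isCommutativeRing = isCommutativeRing }

  open CommutativeRing commutativeRing public using (_-_; semiring)
  open IsStrictTotalOrder isStrictTotalOrder public using (compare; _<?_)

  _/_ : Op₂ Carrier
  x / y = x * y ⁻¹

module Analysis (R : CompleteOrderedField) where

  open CompleteOrderedField R renaming (Carrier to ℝ)
  open RawSemiringDefinitions (Semiring.rawSemiring semiring) public
    using (_^_; sum; product) renaming (_×_ to _·_)

  fromℕ : ℕ → ℝ
  fromℕ n = n · 1#

  -- The infimum is the greatest lower bound.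
  inf : Pred ℝ 0ℓ → ℝ
  inf P = sup (λ y → ∀ x → P x → y ≤ x)

  -- Literally the limit inferior, hence the limit of a convergent sequence.
  lim : (ℕ → ℝ) → ℝ
  lim s = sup (λ y → ∃[ N ] ∀ n → N ℕ.≤ n → y ≤ s n)

  exp : ℝ → ℝ
  exp x = lim (λ n → sum {n} (λ k → x ^ toℕ k / fromℕ (toℕ k !)))

  -- For y > 0 the set is { x | x ≤ log y }; only positive arguments are
  -- meaningful.
  log : ℝ → ℝ
  log y = sup (λ x → exp x ≤ y)

  log₂ : ℝ → ℝ
  log₂ x = log x / log (fromℕ 2)

  -- Binary entropy, in bits.
  H : ℝ → ℝ
  H p = - (p * log₂ p) - (1# - p) * log₂ (1# - p)

  -- KL divergence between Bernoulli(p) and Bernoulli(1-p), in nats.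
  KL : ℝ → ℝ
  KL p = (1# - fromℕ 2 * p) * log ((1# - p) / p)

module NoisySearch (R : CompleteOrderedField) where

  open CompleteOrderedField R renaming (Carrier to ℝ)
  open Analysis R
  open ExtendedStrict _<_ using (_<±_)

  Increasing : ∀ {K} → Vec ℝ K → Set
  Increasing xs = ∀ i j → i Fin.< j → lookup xs i < lookup xs j

  -- X₀ = -∞ , X₁ , … , X_K , X_{K+1} = +∞.
  extended : ∀ {K} → Vec ℝ K → Vec (ℝ ±) (2 ℕ.+ K)
  extended xs = ⊥± ∷ (map [_] xs ∷ʳ ⊤±)

  IsSEARCH : ∀ {K} → Vec ℝ K → ℝ → Fin (suc K) → Set
  IsSEARCH xs X i = lookup (extended xs) (inject₁ i) <± [ X ]
                  × [ X ] <± lookup (extended xs) (suc i)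

  record Distribution (n : ℕ) : Set where
    field
      mass        : Fin n → ℝ
      nonnegative : ∀ i → 0# ≤ mass i
      total       : sum mass ≈ 1#

  open Distribution public

  -- The index i : Fin K stands for X_{i+1} in the 1-based numbering.  The
  -- Boolean is the Bernoulli observation, `true` being the outcome 1.
  Transcript : ℕ → ℕ → Set
  Transcript K T = Vec (Fin K × Bool) T

  -- The output is randomised through its conditional law given the transcript.
  record NonAdaptive (K T : ℕ) : Set where
    field
      sampling : Fin T → Distribution K
      output   : Transcript K T → Distribution (suc K)

  open NonAdaptive public

  Bernoulli : ℝ → Bool → ℝ
  Bernoulli q true  = q
  Bernoulli q false = 1# - q

  -- Only used for X ≠ Xᵢ.
  response : ∀ {K} → ℝ → Vec ℝ K → ℝ → Fin K → Bool → ℝ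
  response p xs X i =
    Bernoulli (if does (lookup xs i <? X) then 1# - p else p)

  sumTranscripts : ∀ {K} T → (Transcript K T → ℝ) → ℝ
  sumTranscripts zero    f = f []
  sumTranscripts (suc T) f = sum λ i →
      sumTranscripts T (λ h → f ((i , true)  ∷ h))
    + sumTranscripts T (λ h → f ((i , false) ∷ h))

  likelihood : ∀ {K T} → ℝ → Vec ℝ K → NonAdaptive K T → ℝ →
               Transcript K T → ℝ
  likelihood p xs A X h = product λ t →
    let i = proj₁ (lookup h t)
        b = proj₂ (lookup h t)
    in  mass (sampling A t) i * response p xs X i b

  -- ℙ(μ̂ ≠ s) when the truth is X.
  ℙ-output≢ : ∀ {K T} → ℝ → Vec ℝ K → NonAdaptive K T → ℝ → Fin (suc K) → ℝ
  ℙ-output≢ {K} {T} p xs A X s = sumTranscripts T λ h →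
    likelihood p xs A X h *
    sum (λ j → if does (j Fin.≟ s) then 0# else mass (output A h) j)

  -- sup_X ℙ(μ̂ ≠ SEARCH(X)).
  worstError : ∀ {K T} → ℝ → Vec ℝ K → NonAdaptive K T → ℝ
  worstError {K} p xs A = sup λ e →
    Σ[ X ∈ ℝ ] (∀ i → ¬ (X ≈ lookup xs i)) ×
    (Σ[ s ∈ Fin (suc K) ] IsSEARCH xs X s × e ≈ ℙ-output≢ p xs A X s)

  minimaxError : ∀ {K} → ℕ → ℝ → Vec ℝ K → ℝ
  minimaxError {K} T p xs = inf λ w →
    Σ[ A ∈ NonAdaptive K T ] w ≈ worstError p xs A

{-# OPTIONS --safe #-}

-- Fix an entry i queried with total probability W at most T/K.  Two positions of X just below and
-- just above the i-th entry give transcript laws whose likelihoods differ only through the answers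
-- to queries of i, so their Bhattacharyya coefficient is G = ∏ₜ (1 - pₜ(i)(1 - 2√(p(1-p)))).
-- Any test satisfies c G ≤ (1 - c²) err + c² for 0 ≤ c ≤ 1, err being the worst error.
-- Jensen's inequality gives G² ≥ exp(- W KL), and c = G/2 then yields err ≥ G²/4.
-- For the second claim c = 99/100 and err ≤ 49/100 force 1 - G ≥ 10⁻⁴, whereas
-- 1 - G ≤ W (1 - 2p)², and (1 - 2p)² is at most KL and at most 8 (1 - H).
module Submission where

open import Defs
open import Data.Nat.Base using (ℕ) renaming (_≤_ to _≤ᴺ_)
open import Data.Product.Base using (Σ-syntax; _×_)
open import Data.Vec.Base using (Vec)

open import Algebra.Bundles using (CommutativeRing)
import Algebra.Properties.Ring
import Algebra.Properties.Semiring.Exp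
import Algebra.Properties.Semiring.Mult
import Algebra.Properties.Semiring.Sum
import Algebra.Solver.Ring
import Algebra.Solver.Ring.AlmostCommutativeRing as ACR
open import Data.Bool.Base using (Bool; true; false; if_then_else_)
open import Data.Fin.Base as Fin using (Fin; zero; suc; toℕ; inject₁)
import Data.Fin.Properties as Fin
open import Data.Fin.Relation.Unary.Top using (view; ‵fromℕ; ‵inject₁)
open import Data.Integer.Base as ℤ using (ℤ; +_; -[1+_])
import Data.Integer.Properties as ℤ
open import Data.Maybe.Base using (Maybe; just; nothing)
open import Data.Nat.Base as ℕ using (zero; suc; _!)
import Data.Nat.Properties as ℕ
open import Data.Product.Base using (∃-syntax; _,_; proj₁; proj₂)
open import Data.Sum.Base using (_⊎_; inj₁; inj₂)
open import Data.Vec.Base as Vec using ([]; _∷_; _∷ʳ_; lookup)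
open import Data.Vec.Properties using (lookup-map)
open import Function.Base using (_∘_)
open import Level using (0ℓ)
open import Relation.Binary.Bundles using (StrictPartialOrder)
import Relation.Binary.Construct.Add.Extrema.Strict as ExtendedStrict
open import Relation.Binary.Definitions using (tri<; tri≈; tri>)
import Relation.Binary.PropositionalEquality.Core as ≡
open ≡ using (_≡_; _≢_)
open import Relation.Binary.Structures using (IsStrictTotalOrder)
open import Relation.Nullary using (¬_; yes; no)
open import Relation.Nullary.Construct.Add.Extrema using (⊥±; [_]; ⊤±)
open import Relation.Nullary.Decidable using (does; dec-true; dec-false)
open import Relation.Nullary.Negation using (contradiction)
open import Relation.Unary using (Pred)

-- For likelihoods x and y, any test has (1 - c²) min(x, y) + c² (x + y) = min + c² max ≥ 2 c √(x
-- y). Keeping c free lets this one inequality serve two regimes. A small c gives an error of order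
-- G², as the exponential claim requires. That claim alone cannot give the K/(1 - H) term: for δ ≥
-- 1/4 the inequality exp(- T KL / K) ≤ 4 δ holds trivially. With c near 1, however, G = 1 would
-- force err ≥ c/(1 + c), and at c = 99/100 this exceeds 49/100. The floor on T so obtained also
-- absorbs the additive log 4 in log(1/δ) ≤ T KL / K + log 4. The reals are given by axioms, with
-- `exp` and `log` defined through suprema, so their theory is developed from the series. A supremum
-- yields approximating elements only by contradiction; convergence is therefore stated up to double
-- negation, which is harmless because the facts drawn from it are inequalities and equalities of
-- reals.

module LowerBounds (R : CompleteOrderedField) where

  open CompleteOrderedField R renaming (Carrier to ℝ)
  open Analysis R
  open NoisySearch R
  open ExtendedStrict _<_ using (_<±_; ⊥±<[_]; [_]; ⊥±<⊤±; [_]<⊤±)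

  private
    module CR = CommutativeRing commutativeRing
    module STO = IsStrictTotalOrder isStrictTotalOrder

  open CR using (refl; sym; trans; +-cong; +-congˡ; +-congʳ; *-cong; *-congˡ; *-congʳ; -‿cong;
    +-assoc; +-comm; +-identityˡ; +-identityʳ; *-assoc; *-comm; *-identityˡ; *-identityʳ;
    zeroˡ; zeroʳ; distribˡ; distribʳ; -‿inverseˡ; -‿inverseʳ)
  open Algebra.Properties.Ring CR.ring using (-‿distribˡ-*; -‿distribʳ-*; -‿+-comm; -‿involutive; -0#≈0#)
  open Algebra.Properties.Semiring.Exp semiring using (^-congˡ)
  open Algebra.Properties.Semiring.Mult semiring using (×-homo-+; ×1-homo-*)
  open Algebra.Properties.Semiring.Sum semiring
    using (sum-cong-≋; ∑-distrib-+; ∑-comm; *-distribˡ-sum; *-distribʳ-sum; sum-replicate)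

  strictPartialOrder : StrictPartialOrder 0ℓ 0ℓ 0ℓ
  strictPartialOrder = record { isStrictPartialOrder = STO.isStrictPartialOrder }

  module ≤R where
    open import Relation.Binary.Reasoning.StrictPartialOrder strictPartialOrder public

  module ≈R where
    open import Relation.Binary.Reasoning.Setoid CR.setoid public

  -- Ring solver with integer coefficients

  -- Zero and one are separate cases so that solver constants denote 0# and 1# on the nose.
  fromℤ : ℤ → ℝ
  fromℤ (+ 0)           = 0#
  fromℤ (+ 1)           = 1#
  fromℤ (+ suc (suc n)) = fromℕ (2 ℕ.+ n)
  fromℤ -[1+ n ]        = - fromℕ (suc n)

  fromℤ-+ : ∀ n → fromℤ (+ n) ≈ fromℕ n
  fromℤ-+ 0             = refl
  fromℤ-+ 1             = sym (+-identityʳ 1#)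
  fromℤ-+ (suc (suc n)) = refl

  fromℤ-⊖ : ∀ m n → fromℤ (m ℤ.⊖ n) ≈ fromℕ m - fromℕ n
  fromℤ-⊖ m zero = trans (fromℤ-+ m) (sym (trans (+-congˡ -0#≈0#) (+-identityʳ _)))
  fromℤ-⊖ zero (suc n) = sym (+-identityˡ _)
  fromℤ-⊖ (suc m) (suc n) = begin
    fromℤ (suc m ℤ.⊖ suc n) ≡⟨ ≡.cong fromℤ (ℤ.[1+m]⊖[1+n]≡m⊖n m n) ⟩
    fromℤ (m ℤ.⊖ n) ≈⟨ fromℤ-⊖ m n ⟩
    fromℕ m - fromℕ n ≈⟨ +-congʳ (+-identityʳ _) ⟨
    (fromℕ m + 0#) - fromℕ n ≈⟨ +-congʳ (+-congˡ (-‿inverseʳ 1#)) ⟨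
    (fromℕ m + (1# - 1#)) - fromℕ n ≈⟨ +-congʳ (+-assoc _ _ _) ⟨
    ((fromℕ m + 1#) - 1#) - fromℕ n ≈⟨ +-congʳ (+-congʳ (+-comm _ _)) ⟩
    (fromℕ (suc m) - 1#) - fromℕ n ≈⟨ +-assoc _ _ _ ⟩
    fromℕ (suc m) + (- 1# - fromℕ n) ≈⟨ +-congˡ (-‿+-comm _ _) ⟩
    fromℕ (suc m) - fromℕ (suc n) ∎
    where open ≈R

  fromℤ-+-homo : ∀ i j → fromℤ (i ℤ.+ j) ≈ fromℤ i + fromℤ j
  fromℤ-+-homo (+ m) (+ n) =
    trans (fromℤ-+ (m ℕ.+ n)) (trans (×-homo-+ 1# m n) (sym (+-cong (fromℤ-+ m) (fromℤ-+ n))))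
  fromℤ-+-homo (+ m) -[1+ n ] = trans (fromℤ-⊖ m (suc n)) (+-congʳ (sym (fromℤ-+ m)))
  fromℤ-+-homo -[1+ m ] (+ n) = trans (fromℤ-⊖ n (suc m)) (trans (+-congʳ (sym (fromℤ-+ n))) (+-comm _ _))
  fromℤ-+-homo -[1+ m ] -[1+ n ] = begin
    - fromℕ (suc (suc (m ℕ.+ n))) ≡⟨ ≡.cong (λ k → - fromℕ (suc k)) (ℕ.+-suc m n) ⟨
    - fromℕ (suc m ℕ.+ suc n) ≈⟨ -‿cong (×-homo-+ 1# (suc m) (suc n)) ⟩
    - (fromℕ (suc m) + fromℕ (suc n)) ≈⟨ -‿+-comm _ _ ⟨
    - fromℕ (suc m) - fromℕ (suc n) ∎
    where open ≈R

  fromℤ-neg-homo : ∀ i → fromℤ (ℤ.- i) ≈ - fromℤ i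
  fromℤ-neg-homo (+ 0)     = sym -0#≈0#
  fromℤ-neg-homo (+ 1)     = -‿cong (+-identityʳ 1#)
  fromℤ-neg-homo (+ suc (suc n)) = refl
  fromℤ-neg-homo -[1+ n ]  = trans (fromℤ-+ (suc n)) (sym (-‿involutive _))

  fromℤ-pos* : ∀ m j → fromℤ (+ m ℤ.* j) ≈ fromℕ m * fromℤ j
  fromℤ-pos* m (+ n) = begin
    fromℤ (+ m ℤ.* + n)  ≡⟨ ≡.cong fromℤ (ℤ.pos-* m n) ⟨
    fromℤ (+ (m ℕ.* n)) ≈⟨ fromℤ-+ (m ℕ.* n) ⟩
    fromℕ (m ℕ.* n) ≈⟨ ×1-homo-* m n ⟩
    fromℕ m * fromℕ n ≈⟨ *-congˡ (fromℤ-+ n) ⟨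
    fromℕ m * fromℤ (+ n) ∎
    where open ≈R
  fromℤ-pos* m -[1+ n ] = begin
    fromℤ (+ m ℤ.* ℤ.- (+ suc n)) ≡⟨ ≡.cong fromℤ (ℤ.neg-distribʳ-* (+ m) (+ suc n)) ⟨
    fromℤ (ℤ.- (+ m ℤ.* + suc n)) ≈⟨ fromℤ-neg-homo (+ m ℤ.* + suc n) ⟩
    - fromℤ (+ m ℤ.* + suc n) ≈⟨ -‿cong (fromℤ-pos* m (+ suc n)) ⟩
    - (fromℕ m * fromℤ (+ suc n)) ≈⟨ -‿cong (*-congˡ (fromℤ-+ (suc n))) ⟩
    - (fromℕ m * fromℕ (suc n)) ≈⟨ -‿distribʳ-* _ _ ⟩
    fromℕ m * - fromℕ (suc n) ∎
    where open ≈R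

  fromℤ-*-homo : ∀ i j → fromℤ (i ℤ.* j) ≈ fromℤ i * fromℤ j
  fromℤ-*-homo (+ m) j = trans (fromℤ-pos* m j) (*-congʳ (sym (fromℤ-+ m)))
  fromℤ-*-homo -[1+ m ] j = begin
    fromℤ (ℤ.- (+ suc m) ℤ.* j) ≡⟨ ≡.cong fromℤ (ℤ.neg-distribˡ-* (+ suc m) j) ⟨
    fromℤ (ℤ.- (+ suc m ℤ.* j)) ≈⟨ fromℤ-neg-homo (+ suc m ℤ.* j) ⟩
    - fromℤ (+ suc m ℤ.* j) ≈⟨ -‿cong (fromℤ-pos* (suc m) j) ⟩
    - (fromℕ (suc m) * fromℤ j) ≈⟨ -‿distribˡ-* _ _ ⟩
    - fromℕ (suc m) * fromℤ j ∎
    where open ≈R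

  ℝ-almostCommutativeRing : ACR.AlmostCommutativeRing 0ℓ 0ℓ
  ℝ-almostCommutativeRing = ACR.fromCommutativeRing commutativeRing

  fromℤ-morphism : ℤ.+-*-rawRing ACR.-Raw-AlmostCommutative⟶ ℝ-almostCommutativeRing
  fromℤ-morphism = record
    { ⟦_⟧ = fromℤ ; +-homo = fromℤ-+-homo ; *-homo = fromℤ-*-homo
    ; -‿homo = fromℤ-neg-homo ; 0-homo = refl ; 1-homo = refl }

  fromℤ-≟ : ∀ i j → Maybe (fromℤ i ≈ fromℤ j)
  fromℤ-≟ i j with i ℤ.≟ j
  ... | yes i≡j = just (CR.reflexive (≡.cong fromℤ i≡j))
  ... | no _ = nothing

  open Algebra.Solver.Ring ℤ.+-*-rawRing ℝ-almostCommutativeRing fromℤ-morphism fromℤ-≟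
    using (solve; _:=_; _:+_; _:*_; _:-_; :-_; con; Polynomial)

  κ : ∀ {n} → ℕ → Polynomial n
  κ n = con (+ n)

  -- Order

  ≤-refl : ∀ {x} → x ≤ x
  ≤-refl = inj₂ refl

  ≈⇒≤ : ∀ {x y} → x ≈ y → x ≤ y
  ≈⇒≤ = inj₂

  <⇒≤ : ∀ {x y} → x < y → x ≤ y
  <⇒≤ = inj₁

  ≤-trans : ∀ {x y z} → x ≤ y → y ≤ z → x ≤ z
  ≤-trans {x} {y} {z} p q = begin x ≤⟨ p ⟩ y ≤⟨ q ⟩ z ∎ where open ≤R

  ≤-<-trans : ∀ {x y z} → x ≤ y → y < z → x < z
  ≤-<-trans {x} {y} {z} p q = begin-strict x ≤⟨ p ⟩ y <⟨ q ⟩ z ∎ where open ≤R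

  <-≤-trans : ∀ {x y z} → x < y → y ≤ z → x < z
  <-≤-trans {x} {y} {z} p q = begin-strict x <⟨ p ⟩ y ≤⟨ q ⟩ z ∎ where open ≤R

  ≤-resp : ∀ {x x′ y y′} → x ≈ x′ → y ≈ y′ → x ≤ y → x′ ≤ y′
  ≤-resp p q r = ≤-trans (≈⇒≤ (sym p)) (≤-trans r (≈⇒≤ q))

  <-resp : ∀ {x x′ y y′} → x ≈ x′ → y ≈ y′ → x < y → x′ < y′
  <-resp p q r = ≤-<-trans (≈⇒≤ (sym p)) (<-≤-trans r (≈⇒≤ q))

  <⇒≱ : ∀ {x y} → x < y → ¬ y ≤ x
  <⇒≱ p q = STO.irrefl refl (<-≤-trans p q)

  ≮⇒≥ : ∀ {x y} → ¬ x < y → y ≤ x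
  ≮⇒≥ {x} {y} ¬p with compare x y
  ... | tri< p _ _ = contradiction p ¬p
  ... | tri≈ _ p _ = inj₂ (sym p)
  ... | tri> _ _ p = inj₁ p

  ≤-stable : ∀ {x y} → ¬ ¬ x ≤ y → x ≤ y
  ≤-stable ¬¬p = ≮⇒≥ λ q → ¬¬p (<⇒≱ q)

  ≤-antisym : ∀ {x y} → x ≤ y → y ≤ x → x ≈ y
  ≤-antisym (inj₂ p) _ = p
  ≤-antisym (inj₁ p) q = contradiction q (<⇒≱ p)

  ≤-total : ∀ x y → x ≤ y ⊎ y ≤ x
  ≤-total x y with compare x y
  ... | tri< p _ _ = inj₁ (inj₁ p)
  ... | tri≈ _ p _ = inj₁ (inj₂ p)
  ... | tri> _ _ p = inj₂ (inj₁ p)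

  <-or-≥ : ∀ x y → x < y ⊎ y ≤ x
  <-or-≥ x y with compare x y
  ... | tri< p _ _ = inj₁ p
  ... | tri≈ _ p _ = inj₂ (inj₂ (sym p))
  ... | tri> _ _ p = inj₂ (inj₁ p)

  +-monoʳ-≤ : ∀ z {x y} → x ≤ y → x + z ≤ y + z
  +-monoʳ-≤ z (inj₁ p) = inj₁ (+-monoˡ-< z p)
  +-monoʳ-≤ z (inj₂ p) = inj₂ (+-congʳ p)

  +-mono-≤ : ∀ {x y u v} → x ≤ y → u ≤ v → x + u ≤ y + v
  +-mono-≤ {x} {y} {u} {v} p q =
    ≤-trans (+-monoʳ-≤ u p) (≤-resp (+-comm _ _) (+-comm _ _) (+-monoʳ-≤ y q))

  +-mono-<-≤ : ∀ {x y u v} → x < y → u ≤ v → x + u < y + v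
  +-mono-<-≤ {x} {y} {u} {v} p q =
    <-≤-trans (+-monoˡ-< u p) (≤-resp (+-comm _ _) (+-comm _ _) (+-monoʳ-≤ y q))

  x≤y⇒0≤y-x : ∀ {x y} → x ≤ y → 0# ≤ y - x
  x≤y⇒0≤y-x {x} p = ≤-resp (-‿inverseʳ x) refl (+-monoʳ-≤ (- x) p)

  x<y⇒0<y-x : ∀ {x y} → x < y → 0# < y - x
  x<y⇒0<y-x {x} p = <-resp (-‿inverseʳ x) refl (+-monoˡ-< (- x) p)

  x+e≈y⇒x≤y : ∀ {x y e} → 0# ≤ e → x + e ≈ y → x ≤ y
  x+e≈y⇒x≤y {x} p q = ≤-resp (+-identityʳ x) q (+-mono-≤ ≤-refl p)

  x+e≈y⇒x<y : ∀ {x y e} → 0# < e → x + e ≈ y → x < y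
  x+e≈y⇒x<y {x} p q = <-resp (+-identityˡ x) (trans (+-comm _ _) q) (+-monoˡ-< x p)

  0≤y-x⇒x≤y : ∀ {x y} → 0# ≤ y - x → x ≤ y
  0≤y-x⇒x≤y {x} {y} p = x+e≈y⇒x≤y p (solve 2 (λ x y → x :+ (y :- x) := y) refl x y)

  +-nonneg : ∀ {x y} → 0# ≤ x → 0# ≤ y → 0# ≤ x + y
  +-nonneg p q = ≤-resp (+-identityˡ _) refl (+-mono-≤ p q)

  +-pos : ∀ {x y} → 0# < x → 0# ≤ y → 0# < x + y
  +-pos p q = <-resp (+-identityˡ _) refl (+-mono-<-≤ p q)

  *-nonneg : ∀ {x y} → 0# ≤ x → 0# ≤ y → 0# ≤ x * y
  *-nonneg (inj₁ p) (inj₁ q) = inj₁ (*-pos p q)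
  *-nonneg (inj₂ p) _ = inj₂ (sym (trans (*-congʳ (sym p)) (zeroˡ _)))
  *-nonneg (inj₁ _) (inj₂ q) = inj₂ (sym (trans (*-congˡ (sym q)) (zeroʳ _)))

  neg-mono-≤ : ∀ {x y} → x ≤ y → - y ≤ - x
  neg-mono-≤ {x} {y} p = x+e≈y⇒x≤y (x≤y⇒0≤y-x p) (solve 2 (λ x y → :- y :+ (y :- x) := :- x) refl x y)

  0≤-x : ∀ {x} → x ≤ 0# → 0# ≤ - x
  0≤-x p = ≤-resp -0#≈0# refl (neg-mono-≤ p)

  *-monoʳ-≤ : ∀ {x y} z → 0# ≤ z → x ≤ y → x * z ≤ y * z
  *-monoʳ-≤ {x} {y} z p q = x+e≈y⇒x≤y (*-nonneg (x≤y⇒0≤y-x q) p)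
    (solve 3 (λ x y z → x :* z :+ (y :- x) :* z := y :* z) refl x y z)

  *-monoˡ-≤ : ∀ {x y} z → 0# ≤ z → x ≤ y → z * x ≤ z * y
  *-monoˡ-≤ z p q = ≤-resp (*-comm _ _) (*-comm _ _) (*-monoʳ-≤ z p q)

  *-monoʳ-< : ∀ {x y} z → 0# < z → x < y → x * z < y * z
  *-monoʳ-< {x} {y} z p q = x+e≈y⇒x<y (*-pos (x<y⇒0<y-x q) p)
    (solve 3 (λ x y z → x :* z :+ (y :- x) :* z := y :* z) refl x y z)

  *-mono-≤ : ∀ {x y u v} → 0# ≤ x → 0# ≤ v → x ≤ y → u ≤ v → x * u ≤ y * v
  *-mono-≤ {x} {y} {u} {v} p q r s = ≤-trans (*-monoˡ-≤ x p s) (*-monoʳ-≤ v q r)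

  *-cancelʳ-≤ : ∀ {x y} z → 0# < z → x * z ≤ y * z → x ≤ y
  *-cancelʳ-≤ z p q = ≮⇒≥ λ r → <⇒≱ (*-monoʳ-< z p r) q

  *-cancelʳ-≈ : ∀ {x y} z → 0# < z → x * z ≈ y * z → x ≈ y
  *-cancelʳ-≈ z p q = ≤-antisym (*-cancelʳ-≤ z p (≈⇒≤ q)) (*-cancelʳ-≤ z p (≈⇒≤ (sym q)))

  square-nonneg : ∀ x → 0# ≤ x * x
  square-nonneg x with ≤-total 0# x
  ... | inj₁ p = *-nonneg p p
  ... | inj₂ p = ≤-resp refl (solve 1 (λ x → (:- x) :* (:- x) := x :* x) refl x) (*-nonneg (0≤-x p) (0≤-x p))

  fromℕ-nonneg : ∀ n → 0# ≤ fromℕ n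
  fromℕ-nonneg zero    = ≤-refl
  fromℕ-nonneg (suc n) = +-nonneg (<⇒≤ 0<1) (fromℕ-nonneg n)

  fromℕ-pos : ∀ n → 0# < fromℕ (suc n)
  fromℕ-pos n = +-pos 0<1 (fromℕ-nonneg n)

  -- Stands in for monotonicity of the square root: if `y < x`, then x² - y² = (x - y)² + 2y (x - y)
  -- is positive.
  square-cancel-≤ : ∀ {x y} → 0# ≤ y → x * x ≤ y * y → x ≤ y
  square-cancel-≤ {x} {y} p q = ≮⇒≥ λ r → <⇒≱
    (x+e≈y⇒x<y (+-pos (*-pos (x<y⇒0<y-x r) (x<y⇒0<y-x r))
      (*-nonneg (*-nonneg (fromℕ-nonneg 2) p) (<⇒≤ (x<y⇒0<y-x r))))
       (solve 2 (λ x y → y :* y :+ ((x :- y) :* (x :- y) :+ κ 2 :* y :* (x :- y)) := x :* x) refl x y)) q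

  <⇒≉ : ∀ {x} → 0# < x → ¬ x ≈ 0#
  <⇒≉ p q = STO.irrefl (sym q) p

  ⁻¹-inverse : ∀ {x} → 0# < x → x * x ⁻¹ ≈ 1#
  ⁻¹-inverse p = ⁻¹-inverseʳ (<⇒≉ p)

  ⁻¹-pos : ∀ {x} → 0# < x → 0# < x ⁻¹
  ⁻¹-pos {x} p with <-or-≥ 0# (x ⁻¹)
  ... | inj₁ q = q
  ... | inj₂ q = contradiction (≤-resp (⁻¹-inverse p) (zeroʳ x) (*-monoˡ-≤ x (<⇒≤ p) q)) (<⇒≱ 0<1)

  /-nonneg : ∀ {x y} → 0# ≤ x → 0# < y → 0# ≤ x / y
  /-nonneg p q = *-nonneg p (<⇒≤ (⁻¹-pos q))

  /-pos : ∀ {x y} → 0# < x → 0# < y → 0# < x / y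
  /-pos p q = *-pos p (⁻¹-pos q)

  x/y*y≈x : ∀ {x y} → 0# < y → x / y * y ≈ x
  x/y*y≈x {x} {y} p = trans (*-assoc _ _ _) (trans (*-congˡ (trans (*-comm _ _) (⁻¹-inverse p)))
    (*-identityʳ x))

  x≤z*y⇒x/y≤z : ∀ {x y z} → 0# < y → x ≤ z * y → x / y ≤ z
  x≤z*y⇒x/y≤z {x} {y} {z} p q = *-cancelʳ-≤ y p (≤-trans (≈⇒≤ (x/y*y≈x p)) q)

  -- Finite sums and products

  sum-mono-≤ : ∀ {n} {f g : Fin n → ℝ} → (∀ i → f i ≤ g i) → sum f ≤ sum g
  sum-mono-≤ {zero}  p = ≤-refl
  sum-mono-≤ {suc n} p = +-mono-≤ (p zero) (sum-mono-≤ λ i → p (suc i))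

  sum-nonneg : ∀ {n} {f : Fin n → ℝ} → (∀ i → 0# ≤ f i) → 0# ≤ sum f
  sum-nonneg {zero}  p = ≤-refl
  sum-nonneg {suc n} p = +-nonneg (p zero) (sum-nonneg λ i → p (suc i))

  -- Suprema.  Inequalities are stable under double negation, so membership, nonemptiness and
  -- boundedness need only be known up to double negation.

  sup-≥ : ∀ P → ¬ ¬ (∃[ u ] UpperBound P u) → ∀ {x} → ¬ ¬ P x → x ≤ sup P
  sup-≥ P bounded {x} ¬¬Px = ≤-stable λ ¬x≤ → ¬¬Px λ Px → bounded λ b → ¬x≤ (sup-upper P (x , Px) b x Px)

  sup-≤ : ∀ P → ¬ ¬ (∃[ x ] P x) → ∀ {u} → UpperBound P u → sup P ≤ u
  sup-≤ P inhabited {u} bound = ≤-stable λ ¬≤ → inhabited λ e → ¬≤ (sup-least P e u bound)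

  -- If no natural number exceeded `x`, the naturals would have a supremum s; as every n + 1 is at
  -- most s, already s - 1 would bound them. Arguing by contradiction yields the witness only up to
  -- double negation.
  archimedean : ∀ x → ¬ ¬ (∃[ n ] x < fromℕ n)
  archimedean x ¬p = <⇒≱ s-1<s (sup-≤ P (λ k → k (0# , zero , ≤-refl)) bound)
    where
    P : Pred ℝ 0ℓ
    P y = ∃[ n ] y ≤ fromℕ n
    s : ℝ
    s = sup P
    bounded : UpperBound P x
    bounded y (n , y≤n) = ≤-trans y≤n (≮⇒≥ λ x<n → ¬p (n , x<n))
    s-1<s : s - 1# < s
    s-1<s = x+e≈y⇒x<y 0<1 (solve 1 (λ s → s :- κ 1 :+ κ 1 := s) refl s)
    bound : UpperBound P (s - 1#)
    bound y (n , y≤n) = ≤-trans y≤n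
      (0≤y-x⇒x≤y (≤-resp refl (solve 2 (λ s n → s :- (κ 1 :+ n) := s :- κ 1 :- n) refl s (fromℕ n))
      (x≤y⇒0≤y-x (sup-≥ P (λ k → k (x , bounded)) (λ k → k (suc n , ≤-refl))))))

  -- Bounds on absolute values

  infix 4 ∣_∣≤_
  ∣_∣≤_ : ℝ → ℝ → Set
  ∣ x ∣≤ b = x ≤ b × - b ≤ x

  ∣∣≤-resp : ∀ {x y b} → x ≈ y → ∣ x ∣≤ b → ∣ y ∣≤ b
  ∣∣≤-resp p (q , r) = ≤-resp p refl q , ≤-resp refl p r

  ∣∣≤-weaken : ∀ {x b c} → b ≤ c → ∣ x ∣≤ b → ∣ x ∣≤ c
  ∣∣≤-weaken p (q , r) = ≤-trans q p , ≤-trans (neg-mono-≤ p) r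

  ∣∣≤-+ : ∀ {x y b c} → ∣ x ∣≤ b → ∣ y ∣≤ c → ∣ x + y ∣≤ b + c
  ∣∣≤-+ {b = b} {c} (p , p′) (q , q′) = +-mono-≤ p q ,
    ≤-resp (solve 2 (λ b c → :- b :+ :- c := :- (b :+ c)) refl b c) refl (+-mono-≤ p′ q′)

  0<2 : 0# < fromℕ 2
  0<2 = fromℕ-pos 1

  -- b c ∓ x y is the mean of (b ∓ x)(c + y) and (b ± x)(c - y).
  ∣∣≤-* : ∀ {x y b c} → ∣ x ∣≤ b → ∣ y ∣≤ c → ∣ x * y ∣≤ b * c
  ∣∣≤-* {x} {y} {b} {c} (p , p′) (q , q′) =
    *-cancelʳ-≤ (fromℕ 2) 0<2 (x+e≈y⇒x≤y (+-nonneg (*-nonneg (x≤y⇒0≤y-x p) (x≤y⇒0≤y-x q′))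
      (*-nonneg (x≤y⇒0≤y-x p′) (x≤y⇒0≤y-x q)))
      (solve 4 (λ x y b c → x :* y :* κ 2 :+ ((b :- x) :* (y :- :- c) :+ (x :- :- b) :* (c :- y))
        := b :* c :* κ 2) refl x y b c)) ,
    *-cancelʳ-≤ (fromℕ 2) 0<2 (x+e≈y⇒x≤y (+-nonneg (*-nonneg (x≤y⇒0≤y-x p′) (x≤y⇒0≤y-x q′))
      (*-nonneg (x≤y⇒0≤y-x p) (x≤y⇒0≤y-x q)))
      (solve 4 (λ x y b c → :- (b :* c) :* κ 2 :+ ((x :- :- b) :* (y :- :- c) :+ (b :- x) :* (c :- y))
        := x :* y :* κ 2) refl x y b c))

  ∣∣-bound : ∀ x → ∃[ u ] 0# ≤ u × ∣ x ∣≤ u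
  ∣∣-bound x with ≤-total 0# x
  ... | inj₁ p = x , p , ≤-refl , ≤-trans (≤-resp refl -0#≈0# (neg-mono-≤ p)) p
  ... | inj₂ p = - x , 0≤-x p , ≤-trans p (0≤-x p) , ≈⇒≤ (solve 1 (λ x → :- (:- x) := x) refl x)

  -- Partial sums and convolutions

  -- For the coefficients `term x` this unfolds to exactly the sequence whose `lim` is `exp x`.
  Σ< : (ℕ → ℝ) → ℕ → ℝ
  Σ< f n = sum {n} λ k → f (toℕ k)

  Σ<-last : ∀ f n → Σ< f (suc n) ≈ Σ< f n + f n
  Σ<-last f zero    = +-comm _ _
  Σ<-last f (suc n) = trans (+-congˡ (Σ<-last (f ∘ suc) n)) (sym (+-assoc _ _ _))

  Σ<-mono : ∀ {f} → (∀ k → 0# ≤ f k) → ∀ {m n} → m ℕ.≤ n → Σ< f m ≤ Σ< f n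
  Σ<-mono 0≤f {n = n} ℕ.z≤n     = sum-nonneg {n} λ k → 0≤f (toℕ k)
  Σ<-mono 0≤f         (ℕ.s≤s p) = +-mono-≤ ≤-refl (Σ<-mono (λ k → 0≤f (suc k)) p)

  Σ<-cong : ∀ n {f g} → (∀ k → f k ≈ g k) → Σ< f n ≈ Σ< g n
  Σ<-cong n p = sum-cong-≋ {n} λ k → p (toℕ k)

  -- The triangle inequality over the terms from m to n - 1. It makes the increments of the
  -- dominating sums control those of `Σ< f`, which is the hypothesis of `⟶-lim`.
  ∣Σ<∣≤ : ∀ {f F} → (∀ k → ∣ f k ∣≤ F k) → ∀ {m n} → m ℕ.≤ n → ∣ Σ< f n - Σ< f m ∣≤ Σ< F n - Σ< F m
  ∣Σ<∣≤ {f} {F} p {n = zero}  ℕ.z≤n = ∣∣≤-resp (sym (-‿inverseʳ 0#)) (≈⇒≤ (sym (-‿inverseʳ 0#)) ,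
    ≈⇒≤ (trans (-‿cong (-‿inverseʳ 0#)) -0#≈0#))
  ∣Σ<∣≤ {f} {F} p {n = suc n} ℕ.z≤n = ∣∣≤-weaken
    (≈⇒≤ (solve 2 (λ x y → x :+ (y :- κ 0) := x :+ y :- κ 0) refl (F 0) (Σ< (F ∘ suc) n)))
    (∣∣≤-resp (solve 2 (λ x y → x :+ (y :- κ 0) := x :+ y :- κ 0) refl (f 0) (Σ< (f ∘ suc) n))
      (∣∣≤-+ (p 0) (∣Σ<∣≤ (λ k → p (suc k)) {n = n} ℕ.z≤n)))
  ∣Σ<∣≤ {f} {F} p {suc m} {suc n} (ℕ.s≤s q) = ∣∣≤-weaken (≈⇒≤ (lem (F 0) (Σ< (F ∘ suc) n) (Σ< (F ∘ suc) m)))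
    (∣∣≤-resp (lem (f 0) (Σ< (f ∘ suc) n) (Σ< (f ∘ suc) m)) (∣Σ<∣≤ (λ k → p (suc k)) q))
    where
    lem : ∀ x y z → y - z ≈ (x + y) - (x + z)
    lem = solve 3 (λ x y z → y :- z := (x :+ y) :- (x :+ z)) refl

  -- Coefficients of the Cauchy product. Shifting `f` in the recursion avoids the truncated
  -- subtraction of Σ f k * g (n - k).
  conv : (ℕ → ℝ) → (ℕ → ℝ) → ℕ → ℝ
  conv f g zero    = f 0 * g 0
  conv f g (suc n) = f 0 * g (suc n) + conv (f ∘ suc) g n

  conv-cong : ∀ n {f f′ g g′} → (∀ k → f k ≈ f′ k) → (∀ k → g k ≈ g′ k) → conv f g n ≈ conv f′ g′ n
  conv-cong zero    p q = *-cong (p 0) (q 0)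
  conv-cong (suc n) p q = +-cong (*-cong (p 0) (q (suc n))) (conv-cong n (λ k → p (suc k)) q)

  conv-+ˡ : ∀ n f f′ g → conv (λ k → f k + f′ k) g n ≈ conv f g n + conv f′ g n
  conv-+ˡ zero    f f′ g = distribʳ _ _ _
  conv-+ˡ (suc n) f f′ g = trans (+-congˡ (conv-+ˡ n (f ∘ suc) (f′ ∘ suc) g))
    (solve 5 (λ a b c d e → (a :+ b) :* c :+ (d :+ e) := (a :* c :+ d) :+ (b :* c :+ e)) refl
      (f 0) (f′ 0) (g (suc n)) (conv (f ∘ suc) g n) (conv (f′ ∘ suc) g n))

  conv-*ˡ : ∀ n x f g → conv (λ k → x * f k) g n ≈ x * conv f g n
  conv-*ˡ zero    x f g = *-assoc _ _ _
  conv-*ˡ (suc n) x f g = trans (+-cong (*-assoc _ _ _) (conv-*ˡ n x (f ∘ suc) g)) (sym (distribˡ _ _ _))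

  conv-*ʳ : ∀ n x f g → conv f (λ k → x * g k) n ≈ x * conv f g n
  conv-*ʳ zero    x f g = solve 3 (λ x f g → f :* (x :* g) := x :* (f :* g)) refl x (f 0) (g 0)
  conv-*ʳ (suc n) x f g = trans (+-congˡ (conv-*ʳ n x (f ∘ suc) g))
    (solve 4 (λ x f g c → f :* (x :* g) :+ x :* c := x :* (f :* g :+ c)) refl x (f 0) (g (suc n))
      (conv (f ∘ suc) g n))

  -- Formal differentiation of the coefficient sequence of a power series.
  ∂ : (ℕ → ℝ) → ℕ → ℝ
  ∂ f k = fromℕ (suc k) * f (suc k)

  -- The product rule for formal power series. With `term-suc` it identifies the product of two
  -- exponential series, taking the place of the binomial theorem.
  conv-leibniz : ∀ n f g → ∂ (conv f g) n ≈ conv (∂ f) g n + conv f (∂ g) n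
  conv-leibniz zero f g =
    solve 4 (λ a b c d → (κ 1 :+ κ 0) :* (a :* d :+ b :* c)
      := (κ 1 :+ κ 0) :* b :* c :+ a :* ((κ 1 :+ κ 0) :* d)) refl
      (f 0) (f 1) (g 0) (g 1)
  conv-leibniz (suc n) f g = begin
    (1# + M) * (f 0 * g₂ + C)
      ≈⟨ solve 4 (λ M f g c → (κ 1 :+ M) :* (f :* g :+ c) := f :* ((κ 1 :+ M) :* g) :+ c :+ M :* c)
        refl M (f 0) g₂ C ⟩
    f 0 * ((1# + M) * g₂) + C + M * C
      ≈⟨ +-congˡ (conv-leibniz n f′ g) ⟩
    f 0 * ((1# + M) * g₂) + (f 1 * g₁ + C′) + (U + V)
      ≈⟨ solve 6 (λ a b c d u v → a :+ (b :* c :+ d) :+ (u :+ v)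
        := (κ 1 :+ κ 0) :* b :* c :+ (d :+ u) :+ (a :+ v)) refl
           (f 0 * ((1# + M) * g₂)) (f 1) g₁ C′ U V ⟩
    (1# + 0#) * f 1 * g₁ + (C′ + U) + (f 0 * ((1# + M) * g₂) + V)
      ≈⟨ +-congʳ (+-congˡ (conv-+ˡ n (f′ ∘ suc) (∂ f′) g)) ⟨
    (1# + 0#) * f 1 * g₁ + conv (λ k → f′ (suc k) + ∂ f′ k) g n + (f 0 * ((1# + M) * g₂) + V)
      ≈⟨ +-congʳ (+-congˡ (conv-cong n (λ k → solve 2 (λ x m → x :+ m :* x := (κ 1 :+ m) :* x)
        refl (f′ (suc k)) (fromℕ (suc k))) (λ _ → refl))) ⟩
    (1# + 0#) * f 1 * g₁ + conv (∂ f ∘ suc) g n + (f 0 * ((1# + M) * g₂) + V) ∎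
    where
    open ≈R
    f′ : ℕ → ℝ
    f′ = f ∘ suc
    M g₁ g₂ C C′ U V : ℝ
    M = fromℕ (suc n)
    g₁ = g (suc n)
    g₂ = g (suc (suc n))
    C = conv f′ g (suc n)
    C′ = conv (f′ ∘ suc) g n
    U = conv (∂ f′) g n
    V = conv f′ (∂ g) n

  -- tri f h n = Σ_{k<n} f k * h (n - k)
  tri : (ℕ → ℝ) → (ℕ → ℝ) → ℕ → ℝ
  tri f h zero    = 0#
  tri f h (suc n) = f 0 * h (suc n) + tri (f ∘ suc) h n

  -- Row k gains the single summand f k * g (n - k), and a new row k = n with the summand f n * g 0
  -- appears; together these make up the convolution.
  tri-suc : ∀ n f g → tri f (Σ< g) (suc n) ≈ tri f (Σ< g) n + conv f g n
  tri-suc zero    f g = solve 2 (λ f g → f :* (g :+ κ 0) :+ κ 0 := κ 0 :+ f :* g) refl (f 0) (g 0)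
  tri-suc (suc n) f g = trans (+-cong (*-congˡ (Σ<-last g (suc n))) (tri-suc n (f ∘ suc) g))
    (solve 5 (λ f s g t c → f :* (s :+ g) :+ (t :+ c) := f :* s :+ t :+ (f :* g :+ c)) refl
      (f 0) (Σ< g (suc n)) (g (suc n)) (tri (f ∘ suc) (Σ< g) n) (conv (f ∘ suc) g n))

  -- Both sides sum f i * g j over the triangle i + j < n, by antidiagonals on the left and by rows
  -- on the right.
  Σ<-conv : ∀ n f g → Σ< (conv f g) n ≈ tri f (Σ< g) n
  Σ<-conv zero    f g = refl
  Σ<-conv (suc n) f g = trans (Σ<-last (conv f g) n) (trans (+-congʳ (Σ<-conv n f g)) (sym (tri-suc n f g)))

  -- The difference is the sum of f i * g j over the n by N rectangle outside the triangle, bounded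
  -- cell by cell. The width N is independent of n because the induction removes rows but no
  -- columns.
  ∣Σ<*Σ<-tri∣≤ : ∀ {f F g G} → (∀ k → ∣ f k ∣≤ F k) → (∀ k → ∣ g k ∣≤ G k) → ∀ {n N} → n ℕ.≤ N →
    ∣ Σ< f n * Σ< g N - tri f (Σ< g) n ∣≤ Σ< F n * Σ< G N - tri F (Σ< G) n
  ∣Σ<*Σ<-tri∣≤ {g = g} {G} p q {zero} {N} n≤N = ∣∣≤-resp (sym (zero-lem (Σ< g N)))
    (≈⇒≤ (sym (zero-lem (Σ< G N))) , ≈⇒≤ (trans (-‿cong (zero-lem (Σ< G N))) -0#≈0#))
    where
    zero-lem : ∀ x → 0# * x - 0# ≈ 0#
    zero-lem = solve 1 (λ x → κ 0 :* x :- κ 0 := κ 0) refl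
  ∣Σ<*Σ<-tri∣≤ {f} {F} {g} {G} p q {suc n} {N} n<N =
    ∣∣≤-weaken (≈⇒≤ (lem (F 0) (Σ< G N) (Σ< G (suc n)) (Σ< (F ∘ suc) n) (tri (F ∘ suc) (Σ< G) n)))
    (∣∣≤-resp (lem (f 0) (Σ< g N) (Σ< g (suc n)) (Σ< (f ∘ suc) n) (tri (f ∘ suc) (Σ< g) n))
      (∣∣≤-+ (∣∣≤-* (p 0) (∣Σ<∣≤ q n<N)) (∣Σ<*Σ<-tri∣≤ (λ k → p (suc k)) q (ℕ.<⇒≤ n<N))))
    where
    lem : ∀ f s s′ t u → f * (s - s′) + (t * s - u) ≈ (f + t) * s - (f * s′ + u)
    lem = solve 5 (λ f s s′ t u → f :* (s :- s′) :+ (t :* s :- u) := (f :+ t) :* s :- (f :* s′ :+ u)) refl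

  tri-nonneg : ∀ {f h} → (∀ k → 0# ≤ f k) → (∀ k → 0# ≤ h k) → ∀ n → 0# ≤ tri f h n
  tri-nonneg p q zero    = ≤-refl
  tri-nonneg p q (suc n) = +-nonneg (*-nonneg (p 0) (q (suc n))) (tri-nonneg (λ k → p (suc k)) q n)

  -- The n by N rectangle lies inside the triangle i + j < n + N.
  Σ<*Σ<≤tri : ∀ {f g} → (∀ k → 0# ≤ f k) → (∀ k → 0# ≤ g k) → ∀ n N → Σ< f n * Σ< g N ≤ tri f (Σ< g) (n ℕ.+ N)
  Σ<*Σ<≤tri p q zero    N = ≤-trans (≈⇒≤ (zeroˡ _)) (tri-nonneg p (λ k → sum-nonneg {k} λ i → q (toℕ i)) N)
  Σ<*Σ<≤tri p q (suc n) N = ≤-trans (≈⇒≤ (distribʳ _ _ _))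
    (+-mono-≤ (*-monoˡ-≤ _ (p 0) (Σ<-mono q (ℕ.m≤n+m N (suc n)))) (Σ<*Σ<≤tri (λ k → p (suc k)) q n N))

  -- Limits

  Near : (ℕ → ℝ) → ℝ → ℝ → Set
  Near s L ε = ∃[ N ] ∀ n → N ℕ.≤ n → ∣ s n - L ∣≤ ε

  infix 4 _⟶_
  -- The threshold index is asserted only up to double negation, since it comes from `archimedean`
  -- or from approaching a supremum.
  _⟶_ : (ℕ → ℝ) → ℝ → Set
  s ⟶ L = ∀ ε → 0# < ε → ¬ ¬ Near s L ε

  -- If `y < x`, testing at ε = (x - y)/8 bounds x by the midpoint of y and x. The factor 4 is the
  -- number of ε-errors that accumulate in `exp-+`; `⟶-mono` incurs two and pads them.
  ∀ε⇒≤ : ∀ {x y} → (∀ ε → 0# < ε → x ≤ y + fromℕ 4 * ε) → x ≤ y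
  ∀ε⇒≤ {x} {y} p = ≮⇒≥ λ y<x → <⇒≱ (half y<x) (p _ (/-pos (x<y⇒0<y-x y<x) (fromℕ-pos 7)))
    where
    half : y < x → y + fromℕ 4 * ((x - y) / fromℕ 8) < x
    half y<x = x+e≈y⇒x<y (*-pos (fromℕ-pos 3) (/-pos (x<y⇒0<y-x y<x) (fromℕ-pos 7)))
      (trans (solve 2 (λ y d → y :+ κ 4 :* d :+ κ 4 :* d := y :+ d :* κ 8) refl y ((x - y) / fromℕ 8))
        (trans (+-congˡ (x/y*y≈x (fromℕ-pos 7))) (solve 2 (λ x y → y :+ (x :- y) := x) refl x y)))

  ⟶-mono : ∀ {s t L M} → s ⟶ L → t ⟶ M → ∀ m → (∀ n → m ℕ.≤ n → s n ≤ t n) → L ≤ M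
  ⟶-mono {s} {t} {L} {M} p q m s≤t = ∀ε⇒≤ λ ε 0<ε → ≤-stable λ ¬g → p ε 0<ε λ (N , r) → q ε 0<ε λ (N′ , r′) →
    ¬g
    let n = m ℕ.+ (N ℕ.+ N′)
        m≤n = ℕ.m≤m+n m (N ℕ.+ N′)
        N≤n = ℕ.≤-trans (ℕ.m≤m+n N N′) (ℕ.m≤n+m (N ℕ.+ N′) m)
        N′≤n = ℕ.≤-trans (ℕ.m≤n+m N′ N) (ℕ.m≤n+m (N ℕ.+ N′) m)
        e = +-nonneg (+-nonneg (x≤y⇒0≤y-x (proj₂ (r n N≤n))) (x≤y⇒0≤y-x (proj₁ (r′ n N′≤n))))
              (+-nonneg (x≤y⇒0≤y-x (s≤t n m≤n)) (*-nonneg (<⇒≤ 0<2) (<⇒≤ 0<ε)))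
    in x+e≈y⇒x≤y e (solve 5 (λ L M ε s t →
      L :+ (((s :- L) :- :- ε :+ (ε :- (t :- M))) :+ ((t :- s) :+ κ 2 :* ε)) := M :+ κ 4 :* ε)
        refl L M ε (s n) (t n))

  ⟶-const : ∀ x → (λ _ → x) ⟶ x
  ⟶-const x ε 0<ε k = k (0 , λ n _ →
    ∣∣≤-resp (sym (-‿inverseʳ x)) (<⇒≤ 0<ε , ≤-resp refl -0#≈0# (neg-mono-≤ (<⇒≤ 0<ε))))

  ⟶-unique : ∀ {s t L M} → s ⟶ L → t ⟶ M → (∀ n → s n ≈ t n) → L ≈ M
  ⟶-unique p q r = ≤-antisym (⟶-mono p q 0 λ n _ → ≈⇒≤ (r n)) (⟶-mono q p 0 λ n _ → ≈⇒≤ (sym (r n)))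

  ⟶-* : ∀ {s t L M} → s ⟶ L → t ⟶ M → (λ n → s n * t n) ⟶ L * M
  ⟶-* {s} {t} {L} {M} p q ε 0<ε k with ∣∣-bound L | ∣∣-bound M
  ... | l , 0≤l , ∣L∣≤l | m , 0≤m , ∣M∣≤m = p η 0<η λ (N , r) → q η 0<η λ (N′ , r′) →
    k (N ℕ.+ N′ , λ n N+N′≤n →
      let r = r n (ℕ.≤-trans (ℕ.m≤m+n N N′) N+N′≤n)
          r′ = r′ n (ℕ.≤-trans (ℕ.m≤n+m N′ N) N+N′≤n)
      in ∣∣≤-weaken bound (∣∣≤-resp
           (solve 4 (λ s t L M → (s :- L) :* (t :- M) :+ (L :* (t :- M) :+ (s :- L) :* M) := s :* t :- L :* M)
             refl (s n) (t n) L M)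
           (∣∣≤-+ (∣∣≤-* r r′) (∣∣≤-+ (∣∣≤-* ∣L∣≤l r′) (∣∣≤-* r ∣M∣≤m)))))
    where
    d η : ℝ
    d = ε + (1# + (l + m))
    -- η < 1 and η (1 + l + m) ≤ ε.
    η = ε / d
    0<d : 0# < d
    0<d = +-pos 0<ε (+-nonneg (<⇒≤ 0<1) (+-nonneg 0≤l 0≤m))
    0<η : 0# < η
    0<η = /-pos 0<ε 0<d
    η≤1 : η ≤ 1#
    η≤1 = x≤z*y⇒x/y≤z 0<d (x+e≈y⇒x≤y (+-nonneg (<⇒≤ 0<1) (+-nonneg 0≤l 0≤m)) (sym (*-identityˡ d)))
    bound : η * η + (l * η + η * m) ≤ ε
    bound = x+e≈y⇒x≤y (+-nonneg (*-nonneg (<⇒≤ 0<η) (x≤y⇒0≤y-x η≤1)) (*-nonneg (<⇒≤ 0<η) (<⇒≤ 0<ε)))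
      (trans (solve 4 (λ η ε l m → η :* η :+ (l :* η :+ η :* m) :+ (η :* (κ 1 :- η) :+ η :* ε)
        := η :* (ε :+ (κ 1 :+ (l :+ m)))) refl η ε l m)
        (x/y*y≈x 0<d))

  Monotone : (ℕ → ℝ) → Set
  Monotone M = ∀ {m n} → m ℕ.≤ n → M m ≤ M n

  -- The comparison test. Once M is within ε of its supremum, its later increments are at most ε,
  -- and hence so are those of s. Then s m - ε is eventually a lower bound of s and s m + ε bounds
  -- all such lower bounds, so the limit inferior lies between them.
  ⟶-lim : ∀ {s M} → Monotone M → ¬ ¬ (∃[ B ] ∀ n → M n ≤ B) →
    (∀ {m n} → m ℕ.≤ n → ∣ s n - s m ∣≤ M n - M m) → s ⟶ lim s
  ⟶-lim {s} {M} mono bounded dom ε 0<ε k = ¬¬N λ (N , q) → k (N , λ m N≤m → close N q m N≤m)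
    where
    Range Eventually : Pred ℝ 0ℓ
    Range y = ∃[ n ] y ≤ M n
    Eventually y = ∃[ N ] ∀ n → N ℕ.≤ n → y ≤ s n
    σ : ℝ
    σ = sup Range
    M≤σ : ∀ n → M n ≤ σ
    M≤σ n = sup-≥ Range (λ j → bounded λ (B , b) → j (B , λ y (n , y≤) → ≤-trans y≤ (b n)))
      (λ j → j (n , ≤-refl))
    ¬¬N : ¬ ¬ (∃[ N ] σ - ε < M N)
    ¬¬N ¬N = <⇒≱ (x+e≈y⇒x<y 0<ε (solve 2 (λ s e → s :- e :+ e := s) refl σ ε))
      (sup-≤ Range (λ j → j (M 0 , 0 , ≤-refl)) λ y (n , y≤) → ≤-trans y≤ (≮⇒≥ λ lt → ¬N (n , lt)))
    module _ (N : ℕ) (q : σ - ε < M N) where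
      cauchy : ∀ m n → N ℕ.≤ m → m ℕ.≤ n → ∣ s n - s m ∣≤ ε
      cauchy m n N≤m m≤n = ∣∣≤-weaken
        (x+e≈y⇒x≤y (+-nonneg (+-nonneg (x≤y⇒0≤y-x (M≤σ n)) (x≤y⇒0≤y-x (mono N≤m))) (x≤y⇒0≤y-x (<⇒≤ q)))
          (solve 5 (λ a b c σ ε → a :- b :+ ((σ :- a) :+ (b :- c) :+ (c :- (σ :- ε))) := ε) refl (M n) (M m)
            (M N) σ ε))
        (dom m≤n)
      lower : ∀ m → N ℕ.≤ m → Eventually (s m - ε)
      lower m N≤m = m , λ n m≤n → x+e≈y⇒x≤y (x≤y⇒0≤y-x (proj₂ (cauchy m n N≤m m≤n)))
        (solve 3 (λ sm sn ε → sm :- ε :+ (sn :- sm :- :- ε) := sn) refl (s m) (s n) ε)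
      upper : ∀ m → N ℕ.≤ m → UpperBound Eventually (s m + ε)
      upper m N≤m y (N′ , p) = ≤-trans (p (N′ ℕ.+ m) (ℕ.m≤m+n N′ m))
        (x+e≈y⇒x≤y (x≤y⇒0≤y-x (proj₁ (cauchy m (N′ ℕ.+ m) N≤m (ℕ.m≤n+m m N′))))
          (solve 3 (λ sm sn ε → sn :+ (ε :- (sn :- sm)) := sm :+ ε) refl (s m) (s (N′ ℕ.+ m)) ε))
      close : ∀ m → N ℕ.≤ m → ∣ s m - lim s ∣≤ ε
      close m N≤m =
        x+e≈y⇒x≤y (x≤y⇒0≤y-x (sup-≥ Eventually (λ j → j (_ , upper m N≤m)) (λ j → j (lower m N≤m))))
          (solve 3 (λ s l ε → s :- l :+ (l :- (s :- ε)) := ε) refl (s m) (lim s) ε) ,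
        x+e≈y⇒x≤y (x≤y⇒0≤y-x (sup-≤ Eventually (λ j → j (_ , lower m N≤m)) (upper m N≤m)))
          (solve 3 (λ s l ε → :- ε :+ (s :+ ε :- l) := s :- l) refl (s m) (lim s) ε)

  -- The exponential series

  term : ℝ → ℕ → ℝ
  term x k = x ^ k / fromℕ (k !)

  fromℕ-!-pos : ∀ k → 0# < fromℕ (k !)
  fromℕ-!-pos k with k ! | ℕ.1≤n! k
  ... | suc m | _ = fromℕ-pos m

  term-zero : ∀ x → term x 0 ≈ 1#
  term-zero x = *-cancelʳ-≈ (fromℕ 1) (fromℕ-pos 0)
    (trans (x/y*y≈x (fromℕ-pos 0)) (solve 0 (κ 1 := κ 1 :* (κ 1 :+ κ 0)) refl))

  term-suc : ∀ x k → ∂ (term x) k ≈ x * term x k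
  term-suc x k = *-cancelʳ-≈ (fromℕ (k !)) (fromℕ-!-pos k) (begin
    fromℕ (suc k) * term x (suc k) * fromℕ (k !)
      ≈⟨ solve 3 (λ m t f → m :* t :* f := t :* (m :* f)) refl (fromℕ (suc k)) (term x (suc k))
        (fromℕ (k !)) ⟩
    term x (suc k) * (fromℕ (suc k) * fromℕ (k !)) ≈⟨ *-congˡ (×1-homo-* (suc k) (k !)) ⟨
    term x (suc k) * fromℕ (suc k !)               ≈⟨ x/y*y≈x (fromℕ-!-pos (suc k)) ⟩
    x * x ^ k                                      ≈⟨ *-congˡ (x/y*y≈x (fromℕ-!-pos k)) ⟨
    x * (term x k * fromℕ (k !))                   ≈⟨ *-assoc _ _ _ ⟨
    x * term x k * fromℕ (k !)                     ∎)
    where open ≈R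

  term-cong : ∀ {x y} → x ≈ y → ∀ k → term x k ≈ term y k
  term-cong p k = *-congʳ (^-congˡ k p)

  term-nonneg : ∀ {x} → 0# ≤ x → ∀ k → 0# ≤ term x k
  term-nonneg {x} p k = /-nonneg (^-nonneg k) (fromℕ-!-pos k)
    where
    ^-nonneg : ∀ k → 0# ≤ x ^ k
    ^-nonneg zero    = <⇒≤ 0<1
    ^-nonneg (suc k) = *-nonneg p (^-nonneg k)

  ∣term∣≤ : ∀ {x u} → ∣ x ∣≤ u → ∀ k → ∣ term x k ∣≤ term u k
  ∣term∣≤ {x} {u} p k = ∣∣≤-* (∣^∣≤ k) (≤-refl , neg≤ (<⇒≤ (⁻¹-pos (fromℕ-!-pos k))))
    where
    neg≤ : ∀ {y} → 0# ≤ y → - y ≤ y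
    neg≤ q = ≤-trans (≤-resp refl -0#≈0# (neg-mono-≤ q)) q
    ∣^∣≤ : ∀ k → ∣ x ^ k ∣≤ u ^ k
    ∣^∣≤ zero    = ≤-refl , neg≤ (<⇒≤ 0<1)
    ∣^∣≤ (suc k) = ∣∣≤-* p (∣^∣≤ k)

  -- Both sequences satisfy ∂ h = (x + y) h with h 0 = 1, and this recurrence determines every
  -- coefficient.
  conv-term : ∀ n x y → conv (term x) (term y) n ≈ term (x + y) n
  conv-term zero    x y = trans (*-cong (term-zero x) (term-zero y))
    (trans (*-identityʳ 1#) (sym (term-zero (x + y))))
  conv-term (suc n) x y = *-cancelʳ-≈ (fromℕ (suc n)) (fromℕ-pos n) (begin
    conv (term x) (term y) (suc n) * fromℕ (suc n)                        ≈⟨ *-comm _ _ ⟩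
    ∂ (conv (term x) (term y)) n                                          ≈⟨ conv-leibniz n (term x)
      (term y) ⟩
    conv (∂ (term x)) (term y) n + conv (term x) (∂ (term y)) n
      ≈⟨ +-cong (conv-cong n (term-suc x) λ _ → refl) (conv-cong n (λ _ → refl) (term-suc y)) ⟩
    conv (λ k → x * term x k) (term y) n + conv (term x) (λ k → y * term y k) n
      ≈⟨ +-cong (conv-*ˡ n x (term x) (term y)) (conv-*ʳ n y (term x) (term y)) ⟩
    x * conv (term x) (term y) n + y * conv (term x) (term y) n           ≈⟨ distribʳ _ _ _ ⟨
    (x + y) * conv (term x) (term y) n                                    ≈⟨ *-congˡ (conv-term n x y) ⟩
    (x + y) * term (x + y) n                                              ≈⟨ term-suc (x + y) n ⟨
    ∂ (term (x + y)) n                                                    ≈⟨ *-comm _ _ ⟩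
    term (x + y) (suc n) * fromℕ (suc n)                                  ∎)
    where open ≈R

  -- Past N ≥ 2u the terms at least halve at each step, so Σ< + 2 term decreases.
  Σ<-term-bounded : ∀ {u} → 0# ≤ u → ¬ ¬ (∃[ B ] ∀ n → Σ< (term u) n ≤ B)
  Σ<-term-bounded {u} 0≤u k = archimedean (fromℕ 2 * u) λ (N , 2u<N) → k (B N , bound N (<⇒≤ 2u<N))
    where
    t : ℕ → ℝ
    t = term u
    B : ℕ → ℝ
    B n = Σ< t n + fromℕ 2 * t n
    module _ (N : ℕ) (2u≤N : fromℕ 2 * u ≤ fromℕ N) where
      N≤N+j : ∀ j → fromℕ N ≤ fromℕ (j ℕ.+ N)
      N≤N+j zero    = ≤-refl
      N≤N+j (suc j) = ≤-trans (N≤N+j j) (x+e≈y⇒x≤y (<⇒≤ 0<1) (+-comm _ _))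
      halve : ∀ j → fromℕ 2 * t (suc (j ℕ.+ N)) ≤ t (j ℕ.+ N)
      halve j = *-cancelʳ-≤ (fromℕ (suc n)) (fromℕ-pos n) (begin
        fromℕ 2 * t (suc n) * fromℕ (suc n)  ≈⟨ solve 3 (λ a b c → a :* b :* c := a :* (c :* b))
          refl (fromℕ 2) (t (suc n)) (fromℕ (suc n)) ⟩
        fromℕ 2 * ∂ t n                      ≈⟨ *-congˡ (term-suc u n) ⟩
        fromℕ 2 * (u * t n)                  ≈⟨ solve 3 (λ a b c → a :* (b :* c) := c :* (a :* b))
          refl (fromℕ 2) u (t n) ⟩
        t n * (fromℕ 2 * u)                  ≤⟨ *-monoˡ-≤ (t n) (term-nonneg 0≤u n)
          (≤-trans 2u≤N (N≤N+j (suc j))) ⟩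
        t n * fromℕ (suc n)                  ∎)
        where
        open ≤R
        n : ℕ
        n = j ℕ.+ N
      decreasing : ∀ j → B (j ℕ.+ N) ≤ B N
      decreasing zero    = ≤-refl
      decreasing (suc j) = ≤-trans (begin
        Σ< t (suc n) + fromℕ 2 * t (suc n)  ≤⟨ +-mono-≤ (≈⇒≤ (Σ<-last t n)) (halve j) ⟩
        Σ< t n + t n + t n                  ≈⟨ solve 2 (λ s t → s :+ t :+ t := s :+ κ 2 :* t)
          refl (Σ< t n) (t n) ⟩
        Σ< t n + fromℕ 2 * t n              ∎) (decreasing j)
        where
        open ≤R
        n : ℕ
        n = j ℕ.+ N
      bound : ∀ n → Σ< t n ≤ B N
      bound n = ≤-trans (Σ<-mono (term-nonneg 0≤u) (ℕ.m≤m+n n N))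
        (≤-trans (x+e≈y⇒x≤y (*-nonneg (<⇒≤ 0<2) (term-nonneg 0≤u (n ℕ.+ N))) refl) (decreasing n))

  ⟶-exp : ∀ x → Σ< (term x) ⟶ exp x
  ⟶-exp x with ∣∣-bound x
  ... | u , 0≤u , ∣x∣≤u = ⟶-lim (Σ<-mono (term-nonneg 0≤u)) (Σ<-term-bounded 0≤u) (∣Σ<∣≤ (∣term∣≤ ∣x∣≤u))

  exp-cong : ∀ {x y} → x ≈ y → exp x ≈ exp y
  exp-cong {x} {y} p = ⟶-unique (⟶-exp x) (⟶-exp y) λ n → Σ<-cong n (term-cong p)

  -- The product of the n-th partial sums is a square of cells, the n-th partial sum at x + y a
  -- triangle inside it. By domination the remaining cells contribute at most the increment from n
  -- to 2n of the series at u + v, which tends to 0 because that series converges.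
  exp-+ : ∀ x y → exp (x + y) ≈ exp x * exp y
  exp-+ x y with ∣∣-bound x | ∣∣-bound y
  ... | u , 0≤u , ∣x∣≤u | v , 0≤v , ∣y∣≤v = ≤-antisym
      (∀ε⇒≤ λ ε 0<ε → ≤-stable λ ¬g → approx ε 0<ε λ (h , _) → ¬g h)
      (∀ε⇒≤ λ ε 0<ε → ≤-stable λ ¬g → approx ε 0<ε λ (_ , h) → ¬g h)
    where
    Σ<-+ : ∀ n x y → Σ< (term (x + y)) n ≈ tri (term x) (Σ< (term y)) n
    Σ<-+ n x y = trans (Σ<-cong n λ k → sym (conv-term k x y)) (Σ<-conv n (term x) (term y))
    gap : ∀ n → ∣ Σ< (term x) n * Σ< (term y) n - Σ< (term (x + y)) n ∣≤ Σ< (term (u + v)) (n ℕ.+ n) - Σ<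
      (term (u + v)) n
    gap n = ∣∣≤-resp (+-congˡ (-‿cong (sym (Σ<-+ n x y)))) (∣∣≤-weaken
      (+-mono-≤ (≤-trans (Σ<*Σ<≤tri (term-nonneg 0≤u) (term-nonneg 0≤v) n n) (≈⇒≤ (sym (Σ<-+ (n ℕ.+ n) u v))))
        (neg-mono-≤ (≈⇒≤ (Σ<-+ n u v))))
      (∣Σ<*Σ<-tri∣≤ (∣term∣≤ ∣x∣≤u) (∣term∣≤ ∣y∣≤v) {n} {n} ℕ.≤-refl))
    approx : ∀ ε → 0# < ε → ¬ ¬ (exp (x + y) ≤ exp x * exp y + fromℕ 4 * ε × exp x * exp y ≤
      exp (x + y) + fromℕ 4 * ε)
    approx ε 0<ε k =
      ⟶-* (⟶-exp x) (⟶-exp y) ε 0<ε λ (N₁ , p₁) → ⟶-exp (x + y) ε 0<ε λ (N₂ , p₂) →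
        ⟶-exp (u + v) ε 0<ε λ (N₃ , p₃) → k
      let n = N₁ ℕ.+ N₂ ℕ.+ N₃
          N₁₂≤n = ℕ.m≤m+n (N₁ ℕ.+ N₂) N₃
          N₃≤n = ℕ.m≤n+m N₃ (N₁ ℕ.+ N₂)
          (a , a′) = p₁ n (ℕ.≤-trans (ℕ.m≤m+n N₁ N₂) N₁₂≤n)
          (b , b′) = p₂ n (ℕ.≤-trans (ℕ.m≤n+m N₂ N₁) N₁₂≤n)
          (_ , c) = p₃ n N₃≤n
          (d , _) = p₃ (n ℕ.+ n) (ℕ.≤-trans N₃≤n (ℕ.m≤m+n n n))
          (g , g′) = gap n
      in x+e≈y⇒x≤y (+-nonneg (+-nonneg (+-nonneg (x≤y⇒0≤y-x a) (x≤y⇒0≤y-x b′))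
        (+-nonneg (x≤y⇒0≤y-x c) (x≤y⇒0≤y-x d))) (x≤y⇒0≤y-x g′))
           (solve 8 (λ P E Q s w w′ W ε →
             E :+ ((ε :- (s :- P) :+ (Q :- E :- :- ε)) :+ ((w :- W :- :- ε) :+ (ε :- (w′ :- W))) :+ (s :- Q :- :- (w′ :- w))) := P :+ κ 4 :* ε) refl
             (exp x * exp y) (exp (x + y)) (Σ< (term (x + y)) n) (Σ< (term x) n * Σ< (term y) n)
             (Σ< (term (u + v)) n) (Σ< (term (u + v)) (n ℕ.+ n)) (exp (u + v)) ε) ,
         x+e≈y⇒x≤y (+-nonneg (+-nonneg (+-nonneg (x≤y⇒0≤y-x a′) (x≤y⇒0≤y-x b))
           (+-nonneg (x≤y⇒0≤y-x c) (x≤y⇒0≤y-x d))) (x≤y⇒0≤y-x g))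
           (solve 8 (λ P E Q s w w′ W ε →
             P :+ ((s :- P :- :- ε :+ (ε :- (Q :- E))) :+ ((w :- W :- :- ε) :+ (ε :- (w′ :- W))) :+ (w′ :- w :- (s :- Q))) := E :+ κ 4 :* ε) refl
             (exp x * exp y) (exp (x + y)) (Σ< (term (x + y)) n) (Σ< (term x) n * Σ< (term y) n)
             (Σ< (term (u + v)) n) (Σ< (term (u + v)) (n ℕ.+ n)) (exp (u + v)) ε)

  -- Elementary properties of exp

  exp-ge-1+ : ∀ {u} → 0# ≤ u → 1# + u ≤ exp u
  exp-ge-1+ {u} 0≤u = ⟶-mono (⟶-const (1# + u)) (⟶-exp u) 2 λ n 2≤n →
    ≤-trans (≈⇒≤ (sym two-terms)) (Σ<-mono (term-nonneg 0≤u) 2≤n)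
    where
    term-one : term u 1 ≈ u
    term-one = *-cancelʳ-≈ (fromℕ 1) (fromℕ-pos 0) (trans (*-comm _ _)
      (trans (term-suc u 0) (trans (*-congˡ (term-zero u)) (solve 1 (λ u → u :* κ 1 := u :* (κ 1 :+ κ 0))
        refl u))))
    two-terms : Σ< (term u) 2 ≈ 1# + u
    two-terms = +-cong (term-zero u) (trans (+-identityʳ _) term-one)

  -- Since term k + 1 is at most u times term k, each partial sum S satisfies S ≤ 1 + u S. The form
  -- without division also covers u ≥ 1.
  [1-u]exp≤1 : ∀ {u} → 0# ≤ u → exp u * (1# - u) ≤ 1#
  [1-u]exp≤1 {u} 0≤u = ⟶-mono (⟶-* (⟶-exp u) (⟶-const (1# - u))) (⟶-const 1#) 0 λ n _ →
    x+e≈y⇒x≤y (x≤y⇒0≤y-x (Σ<≤1+uΣ< n)) (solve 2 (λ s u → s :* (κ 1 :- u) :+ (κ 1 :+ u :* s :- s) := κ 1)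
      refl (Σ< (term u) n) u)
    where
    term-suc-≤ : ∀ k → term u (suc k) ≤ u * term u k
    term-suc-≤ k = ≤-trans (x+e≈y⇒x≤y (*-nonneg (fromℕ-nonneg k) (term-nonneg 0≤u (suc k)))
      (solve 2 (λ t k → t :+ k :* t := (κ 1 :+ k) :* t) refl (term u (suc k)) (fromℕ k))) (≈⇒≤ (term-suc u k))
    Σ<≤1+uΣ< : ∀ n → Σ< (term u) n ≤ 1# + u * Σ< (term u) n
    Σ<≤1+uΣ< zero    = ≤-trans (<⇒≤ 0<1) (≈⇒≤ (solve 1 (λ u → κ 1 := κ 1 :+ u :* κ 0) refl u))
    Σ<≤1+uΣ< (suc n) = +-mono-≤ (≈⇒≤ (term-zero u)) (≤-trans (sum-mono-≤ {n} λ k → term-suc-≤ (toℕ k))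
      (≤-trans (≈⇒≤ (sym (*-distribˡ-sum {n} u λ k → term u (toℕ k))))
        (*-monoˡ-≤ u 0≤u (Σ<-mono (term-nonneg 0≤u) (ℕ.n≤1+n n)))))

  exp-0 : exp 0# ≈ 1#
  exp-0 = ≤-antisym (≤-resp (solve 1 (λ e → e :* (κ 1 :- κ 0) := e) refl (exp 0#)) refl ([1-u]exp≤1 ≤-refl))
    (≤-resp (+-identityʳ 1#) refl (exp-ge-1+ ≤-refl))

  exp-neg-* : ∀ x → exp (- x) * exp x ≈ 1#
  exp-neg-* x = trans (sym (exp-+ (- x) x)) (trans (exp-cong (-‿inverseˡ x)) exp-0)

  exp-pos : ∀ x → 0# < exp x
  exp-pos x with ≤-total 0# x
  ... | inj₁ p = <-≤-trans 0<1 (≤-trans (x+e≈y⇒x≤y p refl) (exp-ge-1+ p))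
  ... | inj₂ p with <-or-≥ 0# (exp x)
  ...   | inj₁ q = q
  ...   | inj₂ q = contradiction
    (≤-resp (exp-neg-* x) (zeroʳ _)
      (*-monoˡ-≤ (exp (- x)) (≤-trans (<⇒≤ 0<1) (≤-trans (x+e≈y⇒x≤y (0≤-x p) refl) (exp-ge-1+ (0≤-x p)))) q))
    (<⇒≱ 0<1)

  1+x≤exp : ∀ x → 1# + x ≤ exp x
  1+x≤exp x with ≤-total 0# x
  ... | inj₁ p = exp-ge-1+ p
  ... | inj₂ p = *-cancelʳ-≤ (exp (- x)) (exp-pos (- x)) (≤-trans
    (≈⇒≤ (solve 2 (λ x e → (κ 1 :+ x) :* e := e :* (κ 1 :- :- x)) refl x (exp (- x))))
    (≤-trans ([1-u]exp≤1 (0≤-x p)) (≈⇒≤ (trans (sym (exp-neg-* x)) (*-comm _ _)))))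

  exp-shift : ∀ x y → exp x ≈ exp y * exp (x - y)
  exp-shift x y = trans (exp-cong (solve 2 (λ x y → x := y :+ (x :- y)) refl x y)) (exp-+ y (x - y))

  -- Convexity of `exp`. Each Jensen step below averages this over points x whose weighted mean is
  -- y, so that the linear terms cancel.
  exp-tangent : ∀ x y → exp y * (1# + (x - y)) ≤ exp x
  exp-tangent x y = ≤-trans (*-monoˡ-≤ (exp y) (<⇒≤ (exp-pos y)) (1+x≤exp (x - y)))
    (≈⇒≤ (sym (exp-shift x y)))

  exp-mono-< : ∀ {x y} → x < y → exp x < exp y
  exp-mono-< {x} {y} p = <-≤-trans (x+e≈y⇒x<y (*-pos (exp-pos x) (x<y⇒0<y-x p))
    (solve 2 (λ e d → e :+ e :* d := e :* (κ 1 :+ d)) refl (exp x) (y - x))) (exp-tangent y x)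

  exp-mono-≤ : ∀ {x y} → x ≤ y → exp x ≤ exp y
  exp-mono-≤ (inj₁ p) = <⇒≤ (exp-mono-< p)
  exp-mono-≤ (inj₂ p) = ≈⇒≤ (exp-cong p)

  exp-cancel-≤ : ∀ {x y} → exp x ≤ exp y → x ≤ y
  exp-cancel-≤ p = ≮⇒≥ λ q → <⇒≱ (exp-mono-< q) p

  -- A gap between exp (log y) and y would leave room to shift log y by an explicit positive h:
  -- upwards within the set whose supremum it is, or downwards to a smaller upper bound.
  exp-log : ∀ {y} → 0# < y → exp (log y) ≈ y
  exp-log {y} 0<y = ≤-antisym (≮⇒≥ not-above) (≮⇒≥ not-below)
    where
    Below : Pred ℝ 0ℓ
    Below x = exp x ≤ y
    upper : ∀ {z} → y ≤ exp z → UpperBound Below z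
    upper p x q = exp-cancel-≤ (≤-trans q p)
    y≤exp-y : y ≤ exp y
    y≤exp-y = ≤-trans (x+e≈y⇒x≤y (<⇒≤ 0<1) (+-comm y 1#)) (1+x≤exp y)
    -- From y * exp (1/y) ≥ y (1 + 1/y) = y + 1 ≥ 1.
    inhabited : Below (- (y ⁻¹))
    inhabited = *-cancelʳ-≤ (exp (y ⁻¹)) (exp-pos _) (≤-trans (≈⇒≤ (exp-neg-* (y ⁻¹)))
      (≤-trans (x+e≈y⇒x≤y (<⇒≤ 0<y) (trans (+-cong (sym (⁻¹-inverse 0<y)) (sym (*-identityʳ y)))
                  (solve 2 (λ y z → y :* z :+ y :* κ 1 := y :* (κ 1 :+ z)) refl y (y ⁻¹))))
        (*-monoˡ-≤ y (<⇒≤ 0<y) (1+x≤exp (y ⁻¹)))))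
    l e : ℝ
    l = log y
    e = exp l
    0<e : 0# < e
    0<e = exp-pos l
    -- If exp l < y, then l + h with h = 1 - e/y still lies below, since exp h ≤ 1/(1 - h) = y/e.
    not-below : ¬ e < y
    not-below e<y = <⇒≱ (x+e≈y⇒x<y 0<h refl) (sup-≥ Below (λ k → k (y , upper y≤exp-y)) (λ k → k l+h-below))
      where
      h : ℝ
      h = (y - e) / y
      0<h : 0# < h
      0<h = /-pos (x<y⇒0<y-x e<y) 0<y
      y[1-h]≈e : y * (1# - h) ≈ e
      y[1-h]≈e = trans (solve 2 (λ y h → y :* (κ 1 :- h) := y :- h :* y) refl y h)
        (trans (+-congˡ (-‿cong (x/y*y≈x 0<y))) (solve 2 (λ y e → y :- (y :- e) := e) refl y e))
      l+h-below : exp (l + h) ≤ y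
      l+h-below = begin
        exp (l + h)                ≈⟨ exp-+ l h ⟩
        e * exp h                  ≈⟨ *-congʳ y[1-h]≈e ⟨
        y * (1# - h) * exp h       ≈⟨ solve 3 (λ y h x → y :* (κ 1 :- h) :* x := y :* (x :* (κ 1 :- h)))
          refl y h (exp h) ⟩
        y * (exp h * (1# - h))     ≤⟨ *-monoˡ-≤ y (<⇒≤ 0<y) ([1-u]exp≤1 (<⇒≤ 0<h)) ⟩
        y * 1#                     ≈⟨ *-identityʳ y ⟩
        y                          ∎
        where open ≤R
    -- Here h = 1 - y/e, and the tangent at l gives exp (l - h) ≥ e (1 - h) = y, so l - h would
    -- already be an upper bound.
    not-above : ¬ y < e
    not-above y<e = <⇒≱ (x+e≈y⇒x<y 0<h (solve 2 (λ l h → l :- h :+ h := l) refl l h))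
      (sup-≤ Below (λ k → k (_ , inhabited)) (upper y≤exp[l-h]))
      where
      h : ℝ
      h = (e - y) / e
      0<h : 0# < h
      0<h = /-pos (x<y⇒0<y-x y<e) 0<e
      y≤exp[l-h] : y ≤ exp (l - h)
      y≤exp[l-h] = begin
        y                        ≈⟨ solve 2 (λ y e → y := e :- (e :- y)) refl y e ⟩
        e - (e - y)              ≈⟨ +-congˡ (-‿cong (x/y*y≈x 0<e)) ⟨
        e - h * e                ≈⟨ solve 3 (λ l h e → e :- h :* e := e :* (κ 1 :+ ((l :- h) :- l)))
          refl l h e ⟩
        e * (1# + (l - h - l))   ≤⟨ exp-tangent (l - h) l ⟩
        exp (l - h)              ∎
        where open ≤R

  -- Positions between consecutive entries

  between : ∀ {l u} → l <± u → ∃[ X ] l <± [ X ] × [ X ] <± u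
  between ⊥±<[ u ] = u - 1# , ⊥±<[ _ ] , [ x+e≈y⇒x<y 0<1 (solve 1 (λ u → u :- κ 1 :+ κ 1 := u) refl u) ]
  between {[ l ]} {[ u ]} [ l<u ] = (l + u) / fromℕ 2 ,
    [ *-cancelʳ-< (<-resp (solve 1 (λ l → l :+ l := l :* κ 2) refl l) (sym (x/y*y≈x 0<2))
      (<-resp refl (+-comm _ _) (+-monoˡ-< l l<u))) ] ,
    [ *-cancelʳ-< (<-resp (sym (x/y*y≈x 0<2)) (solve 1 (λ u → u :+ u := u :* κ 2) refl u) (+-monoˡ-< u l<u)) ]
    where
    *-cancelʳ-< : ∀ {x y} → x * fromℕ 2 < y * fromℕ 2 → x < y
    *-cancelʳ-< {x} {y} p with <-or-≥ x y
    ... | inj₁ q = q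
    ... | inj₂ q = contradiction (*-monoʳ-≤ (fromℕ 2) (<⇒≤ 0<2) q) (<⇒≱ p)
  between ⊥±<⊤± = 0# , ⊥±<[ _ ] , [ _ ]<⊤±
  between {[ l ]} [ _ ]<⊤± = l + 1# , [ x+e≈y⇒x<y 0<1 refl ] , [ _ ]<⊤±

  lookup-∷ʳ-inject₁ : ∀ {A : Set} {n} (v : Vec A n) a i → lookup (v ∷ʳ a) (inject₁ i) ≡ lookup v i
  lookup-∷ʳ-inject₁ (x ∷ v) a zero    = ≡.refl
  lookup-∷ʳ-inject₁ (x ∷ v) a (suc i) = lookup-∷ʳ-inject₁ v a i

  lookup-∷ʳ-fromℕ : ∀ {A : Set} {n} (v : Vec A n) a → lookup (v ∷ʳ a) (Fin.fromℕ n) ≡ a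
  lookup-∷ʳ-fromℕ []      a = ≡.refl
  lookup-∷ʳ-fromℕ (x ∷ v) a = lookup-∷ʳ-fromℕ v a

  lookup-extended : ∀ {K} (xs : Vec ℝ K) j → lookup (extended xs) (suc (inject₁ j)) ≡ [ lookup xs j ]
  lookup-extended xs j = ≡.trans (lookup-∷ʳ-inject₁ (Vec.map [_] xs) ⊤± j) (lookup-map j [_] xs)

  extended-increasing : ∀ {K} (xs : Vec ℝ K) → Increasing xs → ∀ s →
    lookup (extended xs) (inject₁ s) <± lookup (extended xs) (suc s)
  extended-increasing xs inc s with view s
  extended-increasing [] inc .zero | ‵fromℕ = ⊥±<⊤±
  extended-increasing {suc K} xs inc .(Fin.fromℕ (suc K)) | ‵fromℕ =
    ≡.subst₂ _<±_ (≡.sym (lookup-extended xs (Fin.fromℕ K))) (≡.sym (lookup-∷ʳ-fromℕ (Vec.map [_] xs) ⊤±)) [ _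
      ]<⊤±
  extended-increasing xs inc .zero | ‵inject₁ zero =
    ≡.subst (⊥± <±_) (≡.sym (lookup-extended xs zero)) ⊥±<[ _ ]
  extended-increasing xs inc .(suc (inject₁ j)) | ‵inject₁ (suc j) =
    ≡.subst₂ _<±_ (≡.sym (lookup-extended xs (inject₁ j))) (≡.sym (lookup-extended xs (suc j)))
      [ inc (inject₁ j) (suc j) (ℕ.s≤s (ℕ.≤-reflexive (Fin.toℕ-inject₁ j))) ]

  SEARCH-surjective : ∀ {K} (xs : Vec ℝ K) → Increasing xs → ∀ s → ∃[ X ] IsSEARCH xs X s
  SEARCH-surjective xs inc s = between (extended-increasing xs inc s)

  []<±[]⁻¹ : ∀ {x y} → [ x ] <± [ y ] → x < y
  []<±[]⁻¹ [ p ] = p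

  module _ {K} (xs : Vec ℝ K) (inc : Increasing xs) where

    lookup-mono-≤ : ∀ {i j} → toℕ i ℕ.≤ toℕ j → lookup xs i ≤ lookup xs j
    lookup-mono-≤ {i} {j} p with ℕ.m≤n⇒m<n∨m≡n p
    ... | inj₁ q = <⇒≤ (inc i j q)
    ... | inj₂ q = ≈⇒≤ (CR.reflexive (≡.cong (lookup xs) (Fin.toℕ-injective q)))

    -- The zero-based `j` denotes X_{j+1}, so the entries below X are those with j < s. Hence the
    -- strict inequality here and the weak one in `SEARCH-above`.
    SEARCH-below : ∀ {X s} → IsSEARCH xs X s → ∀ j → toℕ j ℕ.< toℕ s → lookup xs j < X
    SEARCH-below {X} {suc s} (p , _) j (ℕ.s≤s j≤s) =
      ≤-<-trans (lookup-mono-≤ j≤s) ([]<±[]⁻¹ (≡.subst (_<± [ X ]) (lookup-extended xs s) p))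

    SEARCH-above : ∀ {X s} → IsSEARCH xs X s → ∀ j → toℕ s ℕ.≤ toℕ j → X < lookup xs j
    SEARCH-above {X} {s} (_ , p) j s≤j with view s
    ... | ‵fromℕ = contradiction (≡.subst (ℕ._≤ toℕ j) (Fin.toℕ-fromℕ K) s≤j) (ℕ.<⇒≱ (Fin.toℕ<n j))
    ... | ‵inject₁ i = <-≤-trans ([]<±[]⁻¹ (≡.subst ([ X ] <±_) (lookup-extended xs i) p))
      (lookup-mono-≤ (≡.subst (ℕ._≤ toℕ j) (Fin.toℕ-inject₁ i) s≤j))

    SEARCH-avoids : ∀ {X s} → IsSEARCH xs X s → ∀ j → ¬ X ≈ lookup xs j
    SEARCH-avoids {X} {s} p j X≈ with ℕ.≤-<-connex (toℕ s) (toℕ j)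
    ... | inj₁ q = STO.irrefl X≈ (SEARCH-above p j q)
    ... | inj₂ q = STO.irrefl (sym X≈) (SEARCH-below p j q)

  -- Sums over transcripts

  sumTranscripts-cong : ∀ {K} T {f g : Transcript K T → ℝ} → (∀ h → f h ≈ g h) → sumTranscripts T f ≈
    sumTranscripts T g
  sumTranscripts-cong     zero    p = p []
  sumTranscripts-cong {K} (suc T) p = sum-cong-≋ {K} λ i →
    +-cong (sumTranscripts-cong T λ h → p ((i , true) ∷ h)) (sumTranscripts-cong T λ h → p ((i , false) ∷ h))

  sumTranscripts-mono-≤ : ∀ {K} T {f g : Transcript K T → ℝ} → (∀ h → f h ≤ g h) → sumTranscripts T f ≤
    sumTranscripts T g
  sumTranscripts-mono-≤     zero    p = p []
  sumTranscripts-mono-≤ {K} (suc T) p = sum-mono-≤ {K} λ i →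
    +-mono-≤ (sumTranscripts-mono-≤ T λ h → p ((i , true) ∷ h)) (sumTranscripts-mono-≤ T λ h →
      p ((i , false) ∷ h))

  sumTranscripts-+ : ∀ {K} T (f g : Transcript K T → ℝ) →
    sumTranscripts T (λ h → f h + g h) ≈ sumTranscripts T f + sumTranscripts T g
  sumTranscripts-+     zero    f g = refl
  sumTranscripts-+ {K} (suc T) f g = trans
    (sum-cong-≋ {K} λ i → trans
      (+-cong (sumTranscripts-+ T (λ h → f ((i , true) ∷ h)) λ h → g ((i , true) ∷ h))
              (sumTranscripts-+ T (λ h → f ((i , false) ∷ h)) λ h → g ((i , false) ∷ h)))
      (interchange _ _ _ _))
    (∑-distrib-+ {K}
      (λ i → sumTranscripts T (λ h → f ((i , true) ∷ h)) + sumTranscripts T (λ h → f ((i , false) ∷ h)))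
      (λ i → sumTranscripts T (λ h → g ((i , true) ∷ h)) + sumTranscripts T (λ h → g ((i , false) ∷ h))))
    where
    interchange : ∀ a b c d → (a + b) + (c + d) ≈ (a + c) + (b + d)
    interchange = solve 4 (λ a b c d → (a :+ b) :+ (c :+ d) := (a :+ c) :+ (b :+ d)) refl

  sumTranscripts-*ˡ : ∀ {K} T x (f : Transcript K T → ℝ) → sumTranscripts T (λ h → x * f h) ≈
    x * sumTranscripts T f
  sumTranscripts-*ˡ     zero    x f = refl
  sumTranscripts-*ˡ {K} (suc T) x f = trans
    (sum-cong-≋ {K} λ i → trans
      (+-cong (sumTranscripts-*ˡ T x λ h → f ((i , true) ∷ h)) (sumTranscripts-*ˡ T x λ h →
        f ((i , false) ∷ h)))
      (sym (distribˡ x (sumTranscripts T λ h → f ((i , true) ∷ h)) (sumTranscripts T λ h →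
        f ((i , false) ∷ h)))))
    (sym (*-distribˡ-sum {K} x λ i → sumTranscripts T (λ h → f ((i , true) ∷ h)) + sumTranscripts T
      (λ h → f ((i , false) ∷ h))))

  -- Independence of the rounds: the distributive law lets a sum over all transcripts be carried out
  -- round by round.
  sumTranscripts-product : ∀ {K} T (F : Fin T → Fin K × Bool → ℝ) →
    sumTranscripts T (λ h → product {T} λ t → F t (lookup h t)) ≈
    product {T} λ t → sum λ i → F t (i , true) + F t (i , false)
  sumTranscripts-product     zero    F = refl
  sumTranscripts-product {K} (suc T) F = trans
    (sum-cong-≋ {K} λ i → trans (+-cong (first (i , true)) (first (i , false)))
      (sym (distribʳ (product {T} tail) (F zero (i , true)) (F zero (i , false)))))
    (sym (*-distribʳ-sum {K} (product {T} tail) λ i → F zero (i , true) + F zero (i , false)))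
    where
    tail : Fin T → ℝ
    tail t = sum λ i → F (suc t) (i , true) + F (suc t) (i , false)
    first : ∀ ib → sumTranscripts T (λ h → F zero ib * product {T} λ t → F (suc t) (lookup h t)) ≈
      F zero ib * product {T} tail
    first ib = trans (sumTranscripts-*ˡ T (F zero ib) λ h → product {T} λ t → F (suc t) (lookup h t))
      (*-congˡ (sumTranscripts-product T λ t → F (suc t)))

  -- Finite products, indicator sums and averages

  product-cong : ∀ {n} {f g : Fin n → ℝ} → (∀ i → f i ≈ g i) → product f ≈ product g
  product-cong {zero}  p = refl
  product-cong {suc n} p = *-cong (p zero) (product-cong λ i → p (suc i))

  product-* : ∀ {n} (f g : Fin n → ℝ) → product (λ i → f i * g i) ≈ product f * product g
  product-* {zero}  f g = sym (*-identityʳ 1#)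
  product-* {suc n} f g = trans (*-congˡ (product-* (λ i → f (suc i)) (λ i → g (suc i))))
    (solve 4 (λ a b c d → (a :* b) :* (c :* d) := (a :* c) :* (b :* d)) refl (f zero) (g zero)
      (product λ i → f (suc i)) (product λ i → g (suc i)))

  product-one : ∀ {n} {f : Fin n → ℝ} → (∀ i → f i ≈ 1#) → product f ≈ 1#
  product-one {zero}  p = refl
  product-one {suc n} p = trans (*-cong (p zero) (product-one λ i → p (suc i))) (*-identityʳ 1#)

  product-nonneg : ∀ {n} {f : Fin n → ℝ} → (∀ i → 0# ≤ f i) → 0# ≤ product f
  product-nonneg {zero}  p = <⇒≤ 0<1
  product-nonneg {suc n} p = *-nonneg (p zero) (product-nonneg λ i → p (suc i))

  exp-sum-≤-product : ∀ {n} (f g : Fin n → ℝ) → (∀ i → exp (f i) ≤ g i) → exp (sum f) ≤ product g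
  exp-sum-≤-product {zero}  f g p = ≈⇒≤ exp-0
  exp-sum-≤-product {suc n} f g p = ≤-trans (≈⇒≤ (exp-+ _ _))
    (*-mono-≤ (<⇒≤ (exp-pos _)) (product-nonneg λ i → ≤-trans (<⇒≤ (exp-pos _)) (p (suc i))) (p zero)
      (exp-sum-≤-product (λ i → f (suc i)) (λ i → g (suc i)) λ i → p (suc i)))

  -- The Weierstrass product inequality; each induction step discards the nonnegative product of the
  -- head and the remaining sum.
  1-sum≤product : ∀ {n} (f : Fin n → ℝ) → (∀ i → 0# ≤ f i) → (∀ i → f i ≤ 1#) → 1# - sum f ≤
    product (λ i → 1# - f i)
  1-sum≤product {zero}  f p q = ≈⇒≤ (solve 0 (κ 1 :- κ 0 := κ 1) refl)
  1-sum≤product {suc n} f p q = ≤-trans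
    (x+e≈y⇒x≤y (*-nonneg (p zero) (sum-nonneg λ i → p (suc i)))
      (solve 2 (λ a s → κ 1 :- (a :+ s) :+ a :* s := (κ 1 :- a) :* (κ 1 :- s))
        refl (f zero) (sum λ i → f (suc i))))
    (*-monoˡ-≤ (1# - f zero) (x≤y⇒0≤y-x (q zero)) (1-sum≤product (λ i → f (suc i)) (λ i → p (suc i)) λ i →
      q (suc i)))

  sum-indicator : ∀ {n} (f : Fin n → ℝ) i → sum (λ j → if does (j Fin.≟ i) then f j else 0#) ≈ f i
  sum-indicator {suc n} f zero    =
    trans (+-congˡ (trans (sum-cong-≋ {n} {λ _ → 0#} {λ _ → 0# * 0#} λ _ → sym (zeroˡ 0#))
      (trans (sym (*-distribˡ-sum {n} 0# λ _ → 0#)) (zeroˡ _)))) (+-identityʳ _)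
  sum-indicator {suc n} f (suc i) = trans (+-identityˡ _) (sum-indicator (λ j → f (suc j)) i)

  term≤sum : ∀ {n} (f : Fin n → ℝ) → (∀ i → 0# ≤ f i) → ∀ i → f i ≤ sum f
  term≤sum f p zero    = x+e≈y⇒x≤y (sum-nonneg λ i → p (suc i)) refl
  term≤sum f p (suc i) = ≤-trans (term≤sum (λ j → f (suc j)) (λ j → p (suc j)) i)
    (x+e≈y⇒x≤y (p zero) (+-comm _ _))

  ∃≤average : ∀ {n} (f : Fin n → ℝ) b → 0# ≤ b → 1 ℕ.≤ n → sum f ≤ fromℕ n * b → ∃[ i ] f i ≤ b
  ∃≤average {suc n} f b 0≤b _ p with <-or-≥ b (f zero)
  ... | inj₂ q = zero , q
  ∃≤average {suc zero} f b 0≤b _ p | inj₁ q =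
    contradiction p (<⇒≱ (<-resp (solve 1 (λ b → b :+ κ 0 := (κ 1 :+ κ 0) :* b) refl b)
      refl (+-monoˡ-< 0# q)))
  ∃≤average {suc (suc n)} f b 0≤b _ p | inj₁ q with ∃≤average {suc n} (λ i → f (suc i)) b 0≤b
    (ℕ.s≤s ℕ.z≤n) smaller
    where
    smaller : sum (λ i → f (suc i)) ≤ fromℕ (suc n) * b
    smaller = x+e≈y⇒x≤y (+-nonneg (x≤y⇒0≤y-x p) (x≤y⇒0≤y-x (<⇒≤ q)))
      (solve 4 (λ b n f s → s :+ (((κ 1 :+ n) :* b :- (f :+ s)) :+ (f :- b)) := n :* b) refl b (fromℕ (suc n))
        (f zero) (sum λ i → f (suc i)))
  ... | i , r = suc i , r

  -- Testing two hypotheses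

  0≤1 : 0# ≤ 1#
  0≤1 = <⇒≤ 0<1

  module _ {c : ℝ} (0≤c : 0# ≤ c) (c≤1 : c ≤ 1#) where

    0≤1-c² : 0# ≤ 1# - c * c
    0≤1-c² = x≤y⇒0≤y-x (≤-trans (*-mono-≤ 0≤c 0≤1 c≤1 c≤1) (≈⇒≤ (*-identityʳ 1#)))

    -- For one transcript, x and y are its likelihoods under the two hypotheses, g is their
    -- geometric mean, and a and b are the probabilities that the output misses each hypothesis.
    -- Summation over transcripts turns g into the Bhattacharyya coefficient.
    mixed-lower-bound-≤ : ∀ {x y g a b} → x ≤ y → 0# ≤ x → 0# ≤ y → g * g ≈ x * y → 0# ≤ b → 1# ≤ a + b →
      fromℕ 2 * c * g ≤ (1# - c * c) * (x * a + y * b) + c * c * (x + y)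
    mixed-lower-bound-≤ {x} {y} {g} {a} {b} x≤y 0≤x 0≤y g² 0≤b 1≤a+b = ≤-trans
      -- 2cg ≤ x + c²y, by (x - c²y)² ≥ 0
      (square-cancel-≤ (+-nonneg 0≤x (*-nonneg (square-nonneg c) 0≤y))
        (x+e≈y⇒x≤y (square-nonneg (x - c * c * y)) (trans
          (+-congʳ (trans (solve 2 (λ c g → (κ 2 :* c :* g) :* (κ 2 :* c :* g) := κ 4 :* c :* c :* (g :* g))
            refl c g) (*-congˡ g²)))
          (solve 3 (λ c x y → κ 4 :* c :* c :* (x :* y) :+ (x :- c :* c :* y) :* (x :- c :* c :* y)
            := (x :+ c :* c :* y) :* (x :+ c :* c :* y)) refl c x y))))
      -- As a + b ≥ 1 and x ≤ y, the error x a + y b is at least x, and (1 - c²) x + c² (x + y) = x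
      -- + c² y.
      (x+e≈y⇒x≤y (*-nonneg 0≤1-c² (+-nonneg (*-nonneg 0≤x (x≤y⇒0≤y-x 1≤a+b)) (*-nonneg (x≤y⇒0≤y-x x≤y) 0≤b)))
        (solve 5 (λ c x y a b → x :+ c :* c :* y :+ (κ 1 :- c :* c) :* (x :* (a :+ b :- κ 1) :+ (y :- x) :* b)
          := (κ 1 :- c :* c) :* (x :* a :+ y :* b) :+ c :* c :* (x :+ y)) refl c x y a b))

    mixed-lower-bound : ∀ {x y g a b} → 0# ≤ x → 0# ≤ y → g * g ≈ x * y → 0# ≤ a → 0# ≤ b → 1# ≤ a + b →
      fromℕ 2 * c * g ≤ (1# - c * c) * (x * a + y * b) + c * c * (x + y)
    mixed-lower-bound {x} {y} 0≤x 0≤y g² 0≤a 0≤b 1≤a+b with ≤-total x y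
    ... | inj₁ x≤y = mixed-lower-bound-≤ x≤y 0≤x 0≤y g² 0≤b 1≤a+b
    ... | inj₂ y≤x = ≤-resp refl (+-cong (*-congˡ (+-comm _ _)) (*-congˡ (+-comm _ _)))
      (mixed-lower-bound-≤ y≤x 0≤y 0≤x (trans g² (*-comm x y)) 0≤a (≤-trans 1≤a+b (≈⇒≤ (+-comm _ _))))

  -- Error probabilities of a non-adaptive algorithm

  mass≤1 : ∀ {n} (d : Distribution n) i → mass d i ≤ 1#
  mass≤1 d i = ≤-trans (term≤sum (mass d) (nonnegative d) i) (≈⇒≤ (total d))

  massOff : ∀ {n} → Distribution n → Fin n → ℝ
  massOff d s = sum λ j → if does (j Fin.≟ s) then 0# else mass d j

  massOff-nonneg : ∀ {n} (d : Distribution n) s → 0# ≤ massOff d s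
  massOff-nonneg d s = sum-nonneg λ j → pointwise j (does (j Fin.≟ s))
    where
    pointwise : ∀ j b → 0# ≤ (if b then 0# else mass d j)
    pointwise j true  = ≤-refl
    pointwise j false = nonnegative d j

  massOff≤1 : ∀ {n} (d : Distribution n) s → massOff d s ≤ 1#
  massOff≤1 d s = ≤-trans (sum-mono-≤ λ j → pointwise j (does (j Fin.≟ s))) (≈⇒≤ (total d))
    where
    pointwise : ∀ j b → (if b then 0# else mass d j) ≤ mass d j
    pointwise j true  = nonnegative d j
    pointwise j false = ≤-refl

  -- Every output differs from `s` or from `s′`, so its mass is counted at least once.
  1≤massOff+massOff : ∀ {n} (d : Distribution n) {s s′} → s ≢ s′ → 1# ≤ massOff d s + massOff d s′
  1≤massOff+massOff {n} d {s} {s′} s≢s′ = ≤-trans (≈⇒≤ (sym (total d))) (≤-trans (sum-mono-≤ {n} pointwise)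
    (≈⇒≤ (∑-distrib-+ {n} (λ j → if does (j Fin.≟ s) then 0# else mass d j) λ j →
      if does (j Fin.≟ s′) then 0# else mass d j)))
    where
    pointwise : ∀ j → mass d j ≤ (if does (j Fin.≟ s) then 0# else mass d j) +
      (if does (j Fin.≟ s′) then 0# else mass d j)
    pointwise j with j Fin.≟ s | j Fin.≟ s′
    ... | yes j≡s | yes j≡s′ = contradiction (≡.trans (≡.sym j≡s) j≡s′) s≢s′
    ... | yes _   | no _     = ≈⇒≤ (sym (+-identityˡ _))
    ... | no _    | yes _    = ≈⇒≤ (sym (+-identityʳ _))
    ... | no _    | no _     = x+e≈y⇒x≤y (nonnegative d j) refl

  module _ {K T} {p : ℝ} (0≤p : 0# ≤ p) (p≤1 : p ≤ 1#) (xs : Vec ℝ K) (A : NonAdaptive K T) where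

    Bernoulli-nonneg : ∀ {r} → 0# ≤ r → r ≤ 1# → ∀ b → 0# ≤ Bernoulli r b
    Bernoulli-nonneg 0≤r r≤1 true  = 0≤r
    Bernoulli-nonneg 0≤r r≤1 false = x≤y⇒0≤y-x r≤1

    Bernoulli-total : ∀ r → Bernoulli r true + Bernoulli r false ≈ 1#
    Bernoulli-total = solve 1 (λ r → r :+ (κ 1 :- r) := κ 1) refl

    response-nonneg : ∀ X j b → 0# ≤ response p xs X j b
    response-nonneg X j b with does (lookup xs j <? X)
    ... | true  = Bernoulli-nonneg (x≤y⇒0≤y-x p≤1)
      (x+e≈y⇒x≤y 0≤p (solve 1 (λ p → κ 1 :- p :+ p := κ 1) refl p)) b
    ... | false = Bernoulli-nonneg 0≤p p≤1 b

    likelihood-nonneg : ∀ X h → 0# ≤ likelihood p xs A X h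
    likelihood-nonneg X h = product-nonneg {T} λ t → *-nonneg (nonnegative (sampling A t) _)
      (response-nonneg X (proj₁ (lookup h t)) (proj₂ (lookup h t)))

    likelihood-total : ∀ X → sumTranscripts T (likelihood p xs A X) ≈ 1#
    likelihood-total X = trans
      (sumTranscripts-product T λ t (j , b) → mass (sampling A t) j * response p xs X j b)
      (product-one {T} λ t → trans
        (sum-cong-≋ {K} λ j → trans (sym (distribˡ _ _ _))
          (trans (*-congˡ (Bernoulli-total _)) (*-identityʳ _)))
        (total (sampling A t)))

    ℙ-output≢≤1 : ∀ X s → ℙ-output≢ p xs A X s ≤ 1#
    ℙ-output≢≤1 X s = ≤-trans
      (sumTranscripts-mono-≤ T λ h → ≤-trans (*-monoˡ-≤ _ (likelihood-nonneg X h) (massOff≤1 (output A h) s))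
        (≈⇒≤ (*-identityʳ _)))
      (≈⇒≤ (likelihood-total X))

    ℙ-output≢≤worstError : Increasing xs → ∀ {X s} → IsSEARCH xs X s → ℙ-output≢ p xs A X s ≤
      worstError p xs A
    ℙ-output≢≤worstError inc {X} {s} X∈s = sup-≥ _
      -- `sup` is specified only for bounded sets; all error probabilities are at most 1.
      (λ k → k (1# , λ { e (X′ , _ , s′ , _ , e≈) → ≤-trans (≈⇒≤ e≈) (ℙ-output≢≤1 X′ s′) }))
      (λ k → k (X , SEARCH-avoids xs inc X∈s , s , X∈s , refl))

    -- ρ plays the role of √(p(1-p)), and the product that of the Bhattacharyya coefficient of the
    -- laws of the transcript for X just below and just above the i-th entry.
    module _ {ρ : ℝ} (0≤ρ : 0# ≤ ρ) (ρ² : ρ * ρ ≈ p * (1# - p)) (inc : Increasing xs) (i : Fin K) where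

      affinity : ℝ
      affinity = product λ t → 1# - mass (sampling A t) i * (1# - (ρ + ρ))

      private
        X⁻ X⁺ : ℝ
        X⁻ = proj₁ (SEARCH-surjective xs inc (inject₁ i))
        X⁺ = proj₁ (SEARCH-surjective xs inc (suc i))
        X⁻∈ : IsSEARCH xs X⁻ (inject₁ i)
        X⁻∈ = proj₂ (SEARCH-surjective xs inc (inject₁ i))
        X⁺∈ : IsSEARCH xs X⁺ (suc i)
        X⁺∈ = proj₂ (SEARCH-surjective xs inc (suc i))

        -- The geometric mean of the responses at `X⁻` and `X⁺`. Both positions lie on the same side
        -- of every entry other than `i`, where it is their common response; at `i` it is √(p (1 -
        -- p)) for either answer.
        geo : Fin K → Bool → ℝ
        geo j b = if does (j Fin.≟ i) then ρ else response p xs X⁻ j b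

        >⇒does≡false : ∀ {X j} → X < lookup xs j → does (lookup xs j <? X) ≡ false
        >⇒does≡false q = dec-false (_ <? _) (λ q′ → STO.asym q q′)

        geo² : ∀ j b → geo j b * geo j b ≈ response p xs X⁻ j b * response p xs X⁺ j b
        geo² j b with j Fin.≟ i
        geo² j b | no j≢i = *-congˡ (CR.reflexive (≡.cong (λ z → Bernoulli (if z then 1# - p else p) b) same))
          where
          same : does (lookup xs j <? X⁻) ≡ does (lookup xs j <? X⁺)
          same with ℕ.<-cmp (toℕ j) (toℕ i)
          ... | tri< j<i _ _ = ≡.trans
            (dec-true (_ <? _) (SEARCH-below xs inc X⁻∈ j
              (≡.subst (toℕ j ℕ.<_) (≡.sym (Fin.toℕ-inject₁ i)) j<i)))
            (≡.sym (dec-true (_ <? _) (SEARCH-below xs inc X⁺∈ j (ℕ.m≤n⇒m≤1+n j<i))))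
          ... | tri≈ _ j≡i _ = contradiction (Fin.toℕ-injective j≡i) j≢i
          ... | tri> _ _ i<j = ≡.trans
            (>⇒does≡false (SEARCH-above xs inc X⁻∈ j
              (≡.subst (ℕ._≤ toℕ j) (≡.sym (Fin.toℕ-inject₁ i)) (ℕ.<⇒≤ i<j))))
            (≡.sym (>⇒does≡false (SEARCH-above xs inc X⁺∈ j i<j)))
        geo² .i b | yes ≡.refl = trans ρ² (trans (flipped b) (sym (CR.reflexive (≡.cong₂
            (λ z z′ → Bernoulli (if z then 1# - p else p) b * Bernoulli (if z′ then 1# - p else p) b)
            (>⇒does≡false (SEARCH-above xs inc X⁻∈ i (ℕ.≤-reflexive (Fin.toℕ-inject₁ i))))
            (dec-true (_ <? _) (SEARCH-below xs inc X⁺∈ i ℕ.≤-refl))))))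
          where
          flipped : ∀ b → p * (1# - p) ≈ Bernoulli p b * Bernoulli (1# - p) b
          flipped true  = refl
          flipped false = solve 1 (λ p → p :* (κ 1 :- p) := (κ 1 :- p) :* (κ 1 :- (κ 1 :- p))) refl p

        geoLikelihood : Transcript K T → ℝ
        geoLikelihood h = product λ t → mass (sampling A t) (proj₁ (lookup h t)) * geo (proj₁ (lookup h t))
          (proj₂ (lookup h t))

        geoLikelihood² : ∀ h → geoLikelihood h * geoLikelihood h ≈
          likelihood p xs A X⁻ h * likelihood p xs A X⁺ h
        geoLikelihood² h = begin
          geoLikelihood h * geoLikelihood h                  ≈⟨ product-* {T} _ _ ⟨
          product (λ t → (m t * g t) * (m t * g t))          ≈⟨ product-cong {T}
            (λ t → trans (interchange _ _ _ _)
              (trans (*-congˡ (geo² (proj₁ (lookup h t)) (proj₂ (lookup h t))))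
                (sym (interchange _ _ _ _)))) ⟩
          product (λ t → (m t * r X⁻ t) * (m t * r X⁺ t))    ≈⟨ product-* {T} _ _ ⟩
          likelihood p xs A X⁻ h * likelihood p xs A X⁺ h    ∎
          where
          open ≈R
          m g : Fin T → ℝ
          m t = mass (sampling A t) (proj₁ (lookup h t))
          g t = geo (proj₁ (lookup h t)) (proj₂ (lookup h t))
          r : ℝ → Fin T → ℝ
          r X t = response p xs X (proj₁ (lookup h t)) (proj₂ (lookup h t))
          interchange : ∀ a b c d → (a * b) * (c * d) ≈ (a * c) * (b * d)
          interchange = solve 4 (λ a b c d → (a :* b) :* (c :* d) := (a :* c) :* (b :* d)) refl

        -- The rounds factor. Within a round, an index other than `i` keeps its mass, while `i`
        -- keeps only the fraction 2ρ of it.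
        geoLikelihood-total : sumTranscripts T geoLikelihood ≈ affinity
        geoLikelihood-total = trans
          (sumTranscripts-product T λ t (j , b) → mass (sampling A t) j * geo j b)
          (product-cong {T} round)
          where
          round : ∀ t → sum (λ j → mass (sampling A t) j * geo j true + mass (sampling A t) j * geo j false) ≈
                        1# - mass (sampling A t) i * (1# - (ρ + ρ))
          round t = begin
            sum (λ j → m j * geo j true + m j * geo j false)             ≈⟨ sum-cong-≋ {K} pointwise ⟩
            sum (λ j → m j + (if does (j Fin.≟ i) then loss j else 0#))  ≈⟨ ∑-distrib-+ {K} m _ ⟩
            sum m + sum (λ j → if does (j Fin.≟ i) then loss j else 0#)  ≈⟨ +-cong (total (sampling A t))
              (sum-indicator loss i) ⟩
            1# + loss i                                                  ∎
            where
            open ≈R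
            m loss : Fin K → ℝ
            m = mass (sampling A t)
            loss j = - (m j * (1# - (ρ + ρ)))
            pointwise : ∀ j → m j * geo j true + m j * geo j false ≈
              m j + (if does (j Fin.≟ i) then loss j else 0#)
            pointwise j with does (j Fin.≟ i)
            ... | true  = solve 2 (λ m ρ → m :* ρ :+ m :* ρ := m :+ :- (m :* (κ 1 :- (ρ :+ ρ)))) refl (m j) ρ
            ... | false = trans (sym (distribˡ _ _ _))
              (trans (*-congˡ (Bernoulli-total _)) (trans (*-identityʳ _) (sym (+-identityʳ _))))

      -- The transcriptwise bound summed over all transcripts. Both likelihoods total 1 and both
      -- errors are at most the worst one, so a common factor 2 cancels.
      affinity≤worstError : ∀ {c} → 0# ≤ c → c ≤ 1# → c * affinity ≤ (1# - c * c) * worstError p xs A + c * c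
      affinity≤worstError {c} 0≤c c≤1 = *-cancelʳ-≤ (fromℕ 2) 0<2 (begin
        c * affinity * fromℕ 2
          ≈⟨ solve 2 (λ c a → c :* a :* κ 2 := κ 2 :* c :* a) refl c affinity ⟩
        fromℕ 2 * c * affinity
          ≈⟨ *-congˡ geoLikelihood-total ⟨
        fromℕ 2 * c * sumTranscripts T geoLikelihood
          ≈⟨ sumTranscripts-*ˡ T _ geoLikelihood ⟨
        sumTranscripts T (λ h → fromℕ 2 * c * geoLikelihood h)
          ≤⟨ sumTranscripts-mono-≤ T (λ h → mixed-lower-bound 0≤c c≤1 (likelihood-nonneg X⁻ h)
            (likelihood-nonneg X⁺ h) (geoLikelihood² h)
               (massOff-nonneg (output A h) (inject₁ i)) (massOff-nonneg (output A h) (suc i))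
                 (1≤massOff+massOff (output A h) inject₁i≢suci)) ⟩
        sumTranscripts T (λ h → d * (P h * a h + Q h * b h) + c * c * (P h + Q h))
          ≈⟨ sumTranscripts-+ T _ _ ⟩
        sumTranscripts T (λ h → d * (P h * a h + Q h * b h)) + sumTranscripts T (λ h → c * c * (P h + Q h))
          ≈⟨ +-cong (trans (sumTranscripts-*ˡ T d _)
            (*-congˡ (sumTranscripts-+ T (λ h → P h * a h) (λ h → Q h * b h))))
                    (trans (sumTranscripts-*ˡ T (c * c) _)
                      (*-congˡ (trans (sumTranscripts-+ T P Q)
                        (+-cong (likelihood-total X⁻) (likelihood-total X⁺))))) ⟩
        d * (ℙ-output≢ p xs A X⁻ (inject₁ i) + ℙ-output≢ p xs A X⁺ (suc i)) + c * c * (1# + 1#)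
          ≤⟨ +-mono-≤ (*-monoˡ-≤ d (0≤1-c² 0≤c c≤1)
            (+-mono-≤ (ℙ-output≢≤worstError inc X⁻∈) (ℙ-output≢≤worstError inc X⁺∈))) ≤-refl ⟩
        d * (w + w) + c * c * (1# + 1#)
          ≈⟨ solve 3 (λ d w c → d :* (w :+ w) :+ c :* c :* (κ 1 :+ κ 1) := (d :* w :+ c :* c) :* κ 2)
            refl d w c ⟩
        (d * w + c * c) * fromℕ 2 ∎)
        where
        open ≤R
        d w : ℝ
        d = 1# - c * c
        w = worstError p xs A
        P Q a b : Transcript K T → ℝ
        P = likelihood p xs A X⁻
        Q = likelihood p xs A X⁺
        a h = massOff (output A h) (inject₁ i)
        b h = massOff (output A h) (suc i)
        inject₁i≢suci : inject₁ i ≢ suc i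
        inject₁i≢suci eq = ℕ.1+n≢n (≡.trans (≡.sym (≡.cong toℕ eq)) (Fin.toℕ-inject₁ i))

  -- Bernoulli(p) against Bernoulli(1-p)

  x/2+x/2≈x : ∀ x → x / fromℕ 2 + x / fromℕ 2 ≈ x
  x/2+x/2≈x x = trans (solve 1 (λ y → y :+ y := y :* κ 2) refl (x / fromℕ 2)) (x/y*y≈x 0<2)

  0<log2 : 0# < log (fromℕ 2)
  0<log2 = <-or-contradiction (<-or-≥ 0# (log (fromℕ 2)))
    where
    <-or-contradiction : 0# < log (fromℕ 2) ⊎ log (fromℕ 2) ≤ 0# → 0# < log (fromℕ 2)
    <-or-contradiction (inj₁ q) = q
    <-or-contradiction (inj₂ q) = contradiction (≤-resp (exp-log 0<2) exp-0 (exp-mono-≤ q))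
      (<⇒≱ (x+e≈y⇒x<y 0<1 (solve 0 (κ 1 :+ κ 1 := κ 2) refl)))

  log2≤1 : log (fromℕ 2) ≤ 1#
  log2≤1 = x+e≈y⇒x≤y (x≤y⇒0≤y-x (≤-trans (1+x≤exp (log (fromℕ 2))) (≈⇒≤ (exp-log 0<2))))
    (solve 1 (λ l → l :+ (κ 2 :- (κ 1 :+ l)) := κ 1) refl (log (fromℕ 2)))

  -- u stands for √(2r), so that r log (2r) = u² log u.
  u²-u≤rlog2r : ∀ {r} → 0# < r → let u = exp ((log r + log (fromℕ 2)) / fromℕ 2) in
    u * u ≈ fromℕ 2 * r × u * u - u ≤ r * (log r + log (fromℕ 2))
  u²-u≤rlog2r {r} 0<r = u² , bound
    where
    a u : ℝ
    a = (log r + log (fromℕ 2)) / fromℕ 2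
    u = exp a
    u² : u * u ≈ fromℕ 2 * r
    u² = trans (sym (exp-+ a a)) (trans (exp-cong (x/2+x/2≈x _)) (trans (exp-+ _ _)
      (trans (*-cong (exp-log 0<r) (exp-log 0<2)) (*-comm _ _))))
    bound : u * u - u ≤ r * (log r + log (fromℕ 2))
    bound = begin
      u * u - u                          ≈⟨ solve 1 (λ u → u :* u :- u := u :* u :- u :* κ 1) refl u ⟩
      u * u - u * 1#                     ≈⟨ +-congˡ (-‿cong (*-congˡ (exp-neg-* a))) ⟨
      u * u - u * (exp (- a) * u)        ≈⟨ solve 2 (λ u e → u :* u :- u :* (e :* u) := u :* u :* (κ 1 :- e))
        refl u (exp (- a)) ⟩
      -- As `a` is log u, this is log u ≥ 1 - 1/u.
      u * u * (1# - exp (- a))           ≤⟨ *-monoˡ-≤ (u * u) (square-nonneg u)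
        (x+e≈y⇒x≤y (x≤y⇒0≤y-x (1+x≤exp (- a)))
                                              (solve 2 (λ a e → κ 1 :- e :+ (e :- (κ 1 :- a)) := a)
                                                refl a (exp (- a)))) ⟩
      u * u * a                          ≈⟨ *-congʳ u² ⟩
      fromℕ 2 * r * a                    ≈⟨ solve 2 (λ r a → κ 2 :* r :* a := r :* (a :+ a)) refl r a ⟩
      r * (a + a)                        ≈⟨ *-congˡ (x/2+x/2≈x _) ⟩
      r * (log r + log (fromℕ 2))        ∎
      where open ≤R

  module _ {p : ℝ} (0<p : 0# < p) (p<½ : p < 1# / fromℕ 2) where

    bias : ℝ
    bias = 1# - fromℕ 2 * p

    0<bias : 0# < bias
    0<bias = x<y⇒0<y-x (<-resp (*-comm _ _) (x/y*y≈x 0<2) (*-monoʳ-< (fromℕ 2) 0<2 p<½))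

    0<1-p : 0# < 1# - p
    0<1-p = <-resp refl (solve 1 (λ p → p :+ (κ 1 :- κ 2 :* p) := κ 1 :- p) refl p) (+-pos 0<p (<⇒≤ 0<bias))

    p≤1 : p ≤ 1#
    p≤1 = 0≤y-x⇒x≤y (<⇒≤ 0<1-p)

    logOdds : ℝ
    logOdds = log ((1# - p) / p)

    p*exp-logOdds : p * exp logOdds ≈ 1# - p
    p*exp-logOdds = trans (*-congˡ (exp-log (/-pos 0<1-p 0<p))) (trans (*-comm _ _) (x/y*y≈x 0<p))

    0≤logOdds : 0# ≤ logOdds
    0≤logOdds = exp-cancel-≤ (*-cancelʳ-≤ p 0<p (x+e≈y⇒x≤y (<⇒≤ 0<bias) (begin
      exp 0# * p + bias  ≈⟨ +-congʳ (*-congʳ exp-0) ⟩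
      1# * p + bias      ≈⟨ solve 1 (λ p → κ 1 :* p :+ (κ 1 :- κ 2 :* p) := κ 1 :- p) refl p ⟩
      1# - p             ≈⟨ p*exp-logOdds ⟨
      p * exp logOdds    ≈⟨ *-comm _ _ ⟩
      exp logOdds * p    ∎)))
      where open ≈R

    -- From exp (- logOdds) = p / (1 - p) ≥ 1 - logOdds.
    bias≤logOdds : bias ≤ logOdds
    bias≤logOdds = x+e≈y⇒x≤y
      (+-nonneg (x≤y⇒0≤y-x (*-monoʳ-≤ (1# - p) (<⇒≤ 0<1-p) (1+x≤exp (- logOdds))))
        (*-nonneg (<⇒≤ 0<p) 0≤logOdds))
      (begin
        bias + ((exp (- logOdds) * (1# - p) - (1# - logOdds) * (1# - p)) + p * logOdds)
          ≈⟨ +-congˡ (+-congʳ (+-congʳ exp-neg)) ⟩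
        bias + ((p - (1# - logOdds) * (1# - p)) + p * logOdds)
          ≈⟨ solve 2 (λ p l → (κ 1 :- κ 2 :* p) :+ ((p :- (κ 1 :- l) :* (κ 1 :- p)) :+ p :* l) := l)
            refl p logOdds ⟩
        logOdds ∎)
      where
      open ≈R
      exp-neg : exp (- logOdds) * (1# - p) ≈ p
      exp-neg = trans (*-congˡ (trans (sym p*exp-logOdds) (*-comm _ _)))
        (trans (sym (*-assoc _ _ _)) (trans (*-congʳ (exp-neg-* logOdds)) (*-identityˡ p)))

    bias²≤KL : bias * bias ≤ KL p
    bias²≤KL = *-monoˡ-≤ bias (<⇒≤ 0<bias) bias≤logOdds

    0<KL : 0# < KL p
    0<KL = <-≤-trans (*-pos 0<bias 0<bias) bias²≤KL

    -- `root` is √(p (1 - p)), because exp `halfLogOdds` is √((1 - p)/p). Written this way it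
    -- exposes the exponent to Jensen's inequality.
    halfLogOdds root : ℝ
    halfLogOdds = logOdds / fromℕ 2
    root = p * exp halfLogOdds

    0≤root : 0# ≤ root
    0≤root = *-nonneg (<⇒≤ 0<p) (<⇒≤ (exp-pos halfLogOdds))

    p*exp²halfLogOdds : p * (exp halfLogOdds * exp halfLogOdds) ≈ 1# - p
    p*exp²halfLogOdds = trans (*-congˡ
      (trans (sym (exp-+ halfLogOdds halfLogOdds)) (exp-cong (x/2+x/2≈x logOdds)))) p*exp-logOdds

    root² : root * root ≈ p * (1# - p)
    root² = trans (solve 2 (λ p e → (p :* e) :* (p :* e) := p :* (p :* (e :* e))) refl p (exp halfLogOdds))
      (*-congˡ p*exp²halfLogOdds)

    -- Exhibits 2 `root` as the mean of exp(`halfLogOdds`) and exp(- `halfLogOdds`) with weights p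
    -- and 1 - p.
    root≈q*exp : root ≈ (1# - p) * exp (- halfLogOdds)
    root≈q*exp = begin
      p * e                  ≈⟨ *-identityʳ _ ⟨
      p * e * 1#             ≈⟨ *-congˡ (exp-neg-* halfLogOdds) ⟨
      p * e * (e⁻¹ * e)      ≈⟨ solve 3 (λ p e f → p :* e :* (f :* e) := p :* (e :* e) :* f) refl p e e⁻¹ ⟩
      p * (e * e) * e⁻¹      ≈⟨ *-congʳ p*exp²halfLogOdds ⟩
      (1# - p) * e⁻¹         ∎
      where
      open ≈R
      e e⁻¹ : ℝ
      e = exp halfLogOdds
      e⁻¹ = exp (- halfLogOdds)

    1-[2root]² : 1# - (root + root) * (root + root) ≈ bias * bias
    1-[2root]² = trans (solve 1 (λ r → κ 1 :- (r :+ r) :* (r :+ r) := κ 1 :- κ 4 :* (r :* r)) refl root)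
      (trans (+-congˡ (-‿cong (*-congˡ root²)))
        (solve 1 (λ p → κ 1 :- κ 4 :* (p :* (κ 1 :- p)) := (κ 1 :- κ 2 :* p) :* (κ 1 :- κ 2 :* p)) refl p))

    2root≤1 : root + root ≤ 1#
    2root≤1 = square-cancel-≤ 0≤1 (0≤y-x⇒x≤y (≤-trans (square-nonneg bias)
      (≈⇒≤ (trans (sym 1-[2root]²) (+-congʳ (sym (*-identityʳ 1#)))))))

    1-2root≤bias² : 1# - (root + root) ≤ bias * bias
    1-2root≤bias² = ≤-trans
      (x+e≈y⇒x≤y (*-nonneg (x≤y⇒0≤y-x 2root≤1) (+-nonneg 0≤root 0≤root))
        (solve 1 (λ s → (κ 1 :- s) :+ (κ 1 :- s) :* s := κ 1 :- s :* s) refl (root + root)))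
      (≈⇒≤ 1-[2root]²)

    -- The mean of `halfLogOdds` and its negative with weights p and 1 - p; it equals - KL p / 2.
    logScale : ℝ
    logScale = - (bias * halfLogOdds)

    0≤bias*halfLogOdds : 0# ≤ bias * halfLogOdds
    0≤bias*halfLogOdds = *-nonneg (<⇒≤ 0<bias) (/-nonneg 0≤logOdds 0<2)

    -- Jensen, through the tangent of exp at m.
    exp-logScale≤2root : exp logScale ≤ root + root
    exp-logScale≤2root = begin
      exp logScale
        ≈⟨ solve 3 (λ e p l → e := p :* (e :* (κ 1 :+ (l :- :- ((κ 1 :- κ 2 :* p) :* l)))) :+
                                   (κ 1 :- p) :* (e :* (κ 1 :+ (:- l :- :- ((κ 1 :- κ 2 :* p) :* l)))))
                                     refl (exp logScale) p halfLogOdds ⟩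
      p * (exp logScale * (1# + (halfLogOdds - logScale))) + (1# - p) *
        (exp logScale * (1# + (- halfLogOdds - logScale)))
        ≤⟨ +-mono-≤ (*-monoˡ-≤ p (<⇒≤ 0<p) (exp-tangent halfLogOdds logScale))
          (*-monoˡ-≤ (1# - p) (<⇒≤ 0<1-p) (exp-tangent (- halfLogOdds) logScale)) ⟩
      p * exp halfLogOdds + (1# - p) * exp (- halfLogOdds)
        ≈⟨ +-congˡ root≈q*exp ⟨
      root + root ∎
      where open ≤R

    -- Jensen again, over whether the round queries the chosen entry: exponent `logScale` with
    -- weight w and exponent 0 otherwise, with the tangent taken at the mean `w * logScale`.
    exp-≤-factor : ∀ {w} → 0# ≤ w → w ≤ 1# → exp (w * logScale) ≤ 1# - w * (1# - (root + root))
    exp-≤-factor {w} 0≤w w≤1 = begin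
      exp (w * logScale)
        ≈⟨ solve 3 (λ e w m → e :=
          (κ 1 :- w) :* (e :* (κ 1 :+ (κ 0 :- w :* m))) :+ w :* (e :* (κ 1 :+ (m :- w :* m))))
            refl (exp (w * logScale)) w logScale ⟩
      (1# - w) * (exp (w * logScale) * (1# + (0# - w * logScale))) + w *
        (exp (w * logScale) * (1# + (logScale - w * logScale)))
        ≤⟨ +-mono-≤ (*-monoˡ-≤ (1# - w) (x≤y⇒0≤y-x w≤1) (≤-trans (exp-tangent 0# (w * logScale)) (≈⇒≤ exp-0)))
                    (*-monoˡ-≤ w 0≤w (≤-trans (exp-tangent logScale (w * logScale)) exp-logScale≤2root)) ⟩
      (1# - w) * 1# + w * (root + root)
        ≈⟨ solve 2 (λ w s → (κ 1 :- w) :* κ 1 :+ w :* s := κ 1 :- w :* (κ 1 :- s)) refl w (root + root) ⟩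
      1# - w * (1# - (root + root)) ∎
      where open ≤R

    -- `Z` is 1 - H in nats, the divergence of Bernoulli(p) from the uniform law, while u = √(2p)
    -- and v = √(2(1 - p)). The divergence dominates a squared Hellinger distance, whence (1 - u)² ≤
    -- 2 Z, and bias = 1 - u² ≤ 2 (1 - u). Finally log 2 ≤ 1 returns to bits.
    bias²≤8[1-H] : bias * bias ≤ fromℕ 8 * (1# - H p)
    bias²≤8[1-H] = ≤-trans bias²≤8Z (*-monoˡ-≤ (fromℕ 8) (fromℕ-nonneg 8) Z≤1-H)
      where
      open ≤R
      l₂ Z u v : ℝ
      l₂ = log (fromℕ 2)
      Z = (1# - H p) * l₂
      u = exp ((log p + l₂) / fromℕ 2)
      v = exp ((log (1# - p) + l₂) / fromℕ 2)
      u² : u * u ≈ fromℕ 2 * p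
      u² = proj₁ (u²-u≤rlog2r 0<p)
      v² : v * v ≈ fromℕ 2 * (1# - p)
      v² = proj₁ (u²-u≤rlog2r 0<1-p)
      Z≈ : Z ≈ p * (log p + l₂) + (1# - p) * (log (1# - p) + l₂)
      Z≈ = trans
        (solve 4 (λ p a b l → (κ 1 :- (:- (p :* a) :- (κ 1 :- p) :* b)) :* l
          := l :+ p :* (a :* l) :+ (κ 1 :- p) :* (b :* l)) refl
          p (log₂ p) (log₂ (1# - p)) l₂)
        (trans (+-cong (+-congˡ (*-congˡ (x/y*y≈x 0<log2))) (*-congˡ (x/y*y≈x 0<log2)))
          (solve 4 (λ p a b l → l :+ p :* a :+ (κ 1 :- p) :* b := p :* (a :+ l) :+ (κ 1 :- p) :* (b :+ l))
            refl p (log p) (log (1# - p)) l₂))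
      u≤1 : u ≤ 1#
      u≤1 = square-cancel-≤ 0≤1 (x+e≈y⇒x≤y (<⇒≤ 0<bias)
        (trans (+-congʳ u²) (solve 1 (λ p → κ 2 :* p :+ (κ 1 :- κ 2 :* p) := κ 1 :* κ 1) refl p)))
      bias≈1-u² : bias ≈ 1# - u * u
      bias≈1-u² = +-congˡ (-‿cong (sym u²))
      -- 2 - u - v = ((1 - u)² + (1 - v)²) / 2, as u² + v² = 2.
      [1-u]²≤2Z : (1# - u) * (1# - u) ≤ fromℕ 2 * Z
      [1-u]²≤2Z = begin
        (1# - u) * (1# - u)
          ≤⟨ x+e≈y⇒x≤y (square-nonneg (1# - v)) refl ⟩
        (1# - u) * (1# - u) + (1# - v) * (1# - v)
          ≈⟨ solve 2 (λ u v → (κ 1 :- u) :* (κ 1 :- u) :+ (κ 1 :- v) :* (κ 1 :- v) :=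
                              κ 2 :* ((u :* u :- u) :+ (v :* v :- v)) :+ (κ 2 :- (u :* u :+ v :* v)))
                                refl u v ⟩
        fromℕ 2 * ((u * u - u) + (v * v - v)) + (fromℕ 2 - (u * u + v * v))
          ≈⟨ +-congˡ (trans (+-congˡ (-‿cong (+-cong u² v²)))
               (solve 1 (λ p → κ 2 :- (κ 2 :* p :+ κ 2 :* (κ 1 :- p)) := κ 0) refl p)) ⟩
        fromℕ 2 * ((u * u - u) + (v * v - v)) + 0#
          ≈⟨ +-identityʳ _ ⟩
        fromℕ 2 * ((u * u - u) + (v * v - v))
          ≤⟨ *-monoˡ-≤ (fromℕ 2) (<⇒≤ 0<2) (+-mono-≤ (proj₂ (u²-u≤rlog2r 0<p)) (proj₂ (u²-u≤rlog2r 0<1-p))) ⟩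
        fromℕ 2 * (p * (log p + l₂) + (1# - p) * (log (1# - p) + l₂))
          ≈⟨ *-congˡ Z≈ ⟨
        fromℕ 2 * Z ∎
      bias≤2[1-u] : bias ≤ fromℕ 2 * (1# - u)
      bias≤2[1-u] = ≤-trans (≈⇒≤ bias≈1-u²)
        (x+e≈y⇒x≤y (square-nonneg (1# - u))
          (solve 1 (λ u → κ 1 :- u :* u :+ (κ 1 :- u) :* (κ 1 :- u) := κ 2 :* (κ 1 :- u)) refl u))
      bias²≤8Z : bias * bias ≤ fromℕ 8 * Z
      bias²≤8Z = begin
        bias * bias                                ≤⟨ *-mono-≤ (<⇒≤ 0<bias)
          (*-nonneg (<⇒≤ 0<2) (x≤y⇒0≤y-x u≤1)) bias≤2[1-u] bias≤2[1-u] ⟩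
        fromℕ 2 * (1# - u) * (fromℕ 2 * (1# - u))  ≈⟨ solve 1
          (λ d → κ 2 :* d :* (κ 2 :* d) := κ 4 :* (d :* d)) refl (1# - u) ⟩
        fromℕ 4 * ((1# - u) * (1# - u))            ≤⟨ *-monoˡ-≤ (fromℕ 4) (fromℕ-nonneg 4) [1-u]²≤2Z ⟩
        fromℕ 4 * (fromℕ 2 * Z)                    ≈⟨ solve 1 (λ z → κ 4 :* (κ 2 :* z) := κ 8 :* z) refl Z ⟩
        fromℕ 8 * Z                                ∎
      -- The sign is required before log 2 may be replaced by 1 in `Z`; it follows from the estimate
      -- by `Z`.
      0≤1-H : 0# ≤ 1# - H p
      0≤1-H = *-cancelʳ-≤ l₂ 0<log2 (≤-trans (≈⇒≤ (zeroˡ l₂))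
        (*-cancelʳ-≤ (fromℕ 8) (fromℕ-pos 7)
          (≤-resp (sym (zeroˡ _)) (*-comm _ _) (≤-trans (square-nonneg bias) bias²≤8Z))))
      Z≤1-H : Z ≤ 1# - H p
      Z≤1-H = ≤-trans (*-monoˡ-≤ (1# - H p) 0≤1-H log2≤1) (≈⇒≤ (*-identityʳ _))

    0<1-H : 0# < 1# - H p
    0<1-H with <-or-≥ 0# (1# - H p)
    ... | inj₁ q = q
    ... | inj₂ q = contradiction
      (≤-trans bias²≤8[1-H] (≤-resp refl (zeroʳ _) (*-monoˡ-≤ (fromℕ 8) (fromℕ-nonneg 8) q)))
      (<⇒≱ (*-pos 0<bias 0<bias))

  -- The lower bounds

  pointMass : ∀ n → Distribution (suc n)
  pointMass n = record
    { mass = λ j → if does (j Fin.≟ zero) then 1# else 0#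
    ; nonnegative = λ j → 0≤if (does (j Fin.≟ zero))
    ; total = sum-indicator {suc n} (λ _ → 1#) zero }
    where
    0≤if : ∀ b → 0# ≤ (if b then 1# else 0#)
    0≤if true  = 0≤1
    0≤if false = ≤-refl

  -- The reciprocal of c. Of the 11 multiples of 100², 8 come from `entropy-term` and 3 from
  -- `KL-term`; the leading 1 is the contribution of T KL / K to log(1/δ).
  queryConstant : ℝ
  queryConstant = 1# + fromℕ 11 * (fromℕ 100 * fromℕ 100)

  0<queryConstant : 0# < queryConstant
  0<queryConstant = +-pos 0<1 (*-nonneg (fromℕ-nonneg 11) (square-nonneg (fromℕ 100)))

  nonAdaptive : ∀ {K} T → 1 ℕ.≤ K → NonAdaptive K T
  nonAdaptive {suc K} T _ = record { sampling = λ _ → pointMass K ; output = λ _ → pointMass (suc K) }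

  module _ {K T : ℕ} (1≤K : 1 ℕ.≤ K) {p : ℝ} (0<p : 0# < p) (p<½ : p < 1# / fromℕ 2)
           (xs : Vec ℝ K) (inc : Increasing xs) (A : NonAdaptive K T) where

    private
      0<K : 0# < fromℕ K
      0<K = pos 1≤K
        where
        pos : ∀ {n} → 1 ℕ.≤ n → 0# < fromℕ n
        pos {suc n} _ = fromℕ-pos n
      τ err μ : ℝ
      τ = fromℕ T / fromℕ K
      err = worstError p xs A
      μ = logScale 0<p p<½

      0≤τ : 0# ≤ τ
      0≤τ = /-nonneg (fromℕ-nonneg T) 0<K

      weight : Fin K → ℝ
      weight i = sum λ t → mass (sampling A t) i

      total-weight : sum weight ≈ fromℕ T
      total-weight = trans (∑-comm {K} {T} λ i t → mass (sampling A t) i)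
        (trans (sum-cong-≋ {T} λ t → total (sampling A t)) (sum-replicate T))

      rarelyQueried : ∃[ i ] weight i ≤ τ
      rarelyQueried = ∃≤average weight τ 0≤τ 1≤K
        (≈⇒≤ (trans total-weight (trans (sym (x/y*y≈x 0<K)) (*-comm _ _))))

      i : Fin K
      i = proj₁ rarelyQueried

      w : Fin T → ℝ
      w t = mass (sampling A t) i

      0≤w : ∀ t → 0# ≤ w t
      0≤w t = nonnegative (sampling A t) i

      w≤1 : ∀ t → w t ≤ 1#
      w≤1 t = mass≤1 (sampling A t) i

      G s : ℝ
      G = affinity (<⇒≤ 0<p) (p≤1 0<p p<½) xs A (0≤root 0<p p<½) (root² 0<p p<½) inc i
      s = root 0<p p<½ + root 0<p p<½

      two-point : ∀ {c} → 0# ≤ c → c ≤ 1# → c * G ≤ (1# - c * c) * err + c * c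
      two-point = affinity≤worstError (<⇒≤ 0<p) (p≤1 0<p p<½) xs A (0≤root 0<p p<½) (root² 0<p p<½) inc i

      -- At c = 1 the error drops out of the two-point bound.
      G≤1 : G ≤ 1#
      G≤1 = ≤-resp (*-identityˡ G) (solve 1 (λ e → (κ 1 :- κ 1 :* κ 1) :* e :+ κ 1 :* κ 1 := κ 1) refl err)
        (two-point 0≤1 ≤-refl)

      -- At c = 0 only the error remains in the two-point bound.
      0≤err : 0# ≤ err
      0≤err = ≤-resp (zeroˡ G) (solve 1 (λ e → (κ 1 :- κ 0 :* κ 0) :* e :+ κ 0 :* κ 0 := e) refl err)
        (two-point ≤-refl 0≤1)

      exp[τμ]≤G : exp (τ * μ) ≤ G
      exp[τμ]≤G = ≤-trans (exp-mono-≤ (≤-trans τμ≤ (≈⇒≤ (*-distribʳ-sum {T} μ w))))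
        (exp-sum-≤-product {T} (λ t → w t * μ) (λ t → 1# - w t * (1# - s)) λ t →
          exp-≤-factor 0<p p<½ (0≤w t) (w≤1 t))
        where
        τμ≤ : τ * μ ≤ weight i * μ
        -- The scale `μ` is nonpositive, so the upper bound `τ` on the weight reverses into a lower
        -- bound on the exponent.
        τμ≤ = x+e≈y⇒x≤y (*-nonneg (x≤y⇒0≤y-x (proj₂ rarelyQueried)) (0≤bias*halfLogOdds 0<p p<½))
          (solve 3 (λ a b c → a :* :- c :+ (a :- b) :* c := b :* :- c) refl τ (weight i)
            (bias 0<p p<½ * halfLogOdds 0<p p<½))

      1-G≤τbias² : 1# - G ≤ τ * (bias 0<p p<½ * bias 0<p p<½)
      1-G≤τbias² = begin
        1# - G
          ≤⟨ +-mono-≤ ≤-refl (neg-mono-≤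
            (1-sum≤product {T} (λ t → w t * (1# - s)) (λ t → *-nonneg (0≤w t) 0≤1-s)
               λ t → ≤-trans (*-mono-≤ (0≤w t) 0≤1 (w≤1 t) 1-s≤1) (≈⇒≤ (*-identityʳ 1#)))) ⟩
        1# - (1# - sum (λ t → w t * (1# - s)))
          ≈⟨ solve 1 (λ x → κ 1 :- (κ 1 :- x) := x) refl (sum λ t → w t * (1# - s)) ⟩
        sum (λ t → w t * (1# - s))
          ≈⟨ *-distribʳ-sum {T} (1# - s) w ⟨
        weight i * (1# - s)
          ≤⟨ *-mono-≤ (sum-nonneg {T} 0≤w) (square-nonneg (bias 0<p p<½)) (proj₂ rarelyQueried)
            (1-2root≤bias² 0<p p<½) ⟩
        τ * (bias 0<p p<½ * bias 0<p p<½) ∎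
        where
        open ≤R
        0≤1-s : 0# ≤ 1# - s
        0≤1-s = x≤y⇒0≤y-x (2root≤1 0<p p<½)
        1-s≤1 : 1# - s ≤ 1#
        1-s≤1 = x+e≈y⇒x≤y (+-nonneg (0≤root 0<p p<½) (0≤root 0<p p<½)) (solve 1 (λ s → κ 1 :- s :+ s := κ 1)
          refl s)

    -- The two-point bound with c = G/2 reads G²/4 ≤ (1 - G²/4) err.
    exp-bound : 1# / fromℕ 4 * exp (- (fromℕ T * KL p / fromℕ K)) ≤ worstError p xs A
    exp-bound = begin
      1# / fromℕ 4 * exp (- (fromℕ T * KL p / fromℕ K))
        ≈⟨ *-congˡ (trans (exp-cong exponent) (exp-+ _ _)) ⟩
      1# / fromℕ 4 * (exp (τ * μ) * exp (τ * μ))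
        ≤⟨ *-monoˡ-≤ _ (/-nonneg 0≤1 (fromℕ-pos 3))
          (*-mono-≤ (<⇒≤ (exp-pos _)) (≤-trans (<⇒≤ (exp-pos _)) exp[τμ]≤G) exp[τμ]≤G exp[τμ]≤G) ⟩
      1# / fromℕ 4 * (G * G)
        ≈⟨ *-congˡ (*-cong (x/2+x/2≈x G) (x/2+x/2≈x G)) ⟨
      1# / fromℕ 4 * ((c + c) * (c + c))
        ≈⟨ solve 2 (λ f c → f :* ((c :+ c) :* (c :+ c)) := (f :* κ 4) :* (c :* c)) refl (1# / fromℕ 4) c ⟩
      (1# / fromℕ 4 * fromℕ 4) * (c * c)
        ≈⟨ trans (*-congʳ (x/y*y≈x (fromℕ-pos 3))) (*-identityˡ _) ⟩
      c * c
        ≤⟨ x+e≈y⇒x≤y (+-nonneg (x≤y⇒0≤y-x (≤-resp (*-congˡ (sym (x/2+x/2≈x G))) refl (two-point 0≤c c≤1)))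
          (*-nonneg (square-nonneg c) 0≤err))
             (solve 2 (λ c e → c :* c :+ (((κ 1 :- c :* c) :* e :+ c :* c :- c :* (c :+ c)) :+ c :* c :* e)
               := e) refl c err) ⟩
      err ∎
      where
      open ≤R
      c : ℝ
      c = G / fromℕ 2
      0≤c : 0# ≤ c
      0≤c = /-nonneg (≤-trans (<⇒≤ (exp-pos _)) exp[τμ]≤G) 0<2
      c≤1 : c ≤ 1#
      c≤1 = ≤-trans (x+e≈y⇒x≤y 0≤c (x/2+x/2≈x G)) G≤1
      exponent : - (fromℕ T * KL p / fromℕ K) ≈ τ * μ + τ * μ
      exponent = trans (-‿cong (*-congʳ (*-congˡ (*-congˡ (sym (x/2+x/2≈x (logOdds 0<p p<½)))))))
        (solve 4 (λ t k b l → :- (t :* (b :* (l :+ l)) :* k)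
          := t :* k :* :- (b :* l) :+ t :* k :* :- (b :* l)) refl
          (fromℕ T) (fromℕ K ⁻¹) (bias 0<p p<½) (halfLogOdds 0<p p<½))

    -- Number of queries needed for error probability δ

    module _ {δ : ℝ} (0<δ : 0# < δ) (δ<49/100 : δ < fromℕ 49 / fromℕ 100) (err≤δ : worstError p xs A ≤
      δ) where

      private
        N h B D : ℝ
        N = fromℕ 100
        h = N ⁻¹
        B = bias 0<p p<½ * bias 0<p p<½
        D = KL p

        0<N : 0# < N
        0<N = fromℕ-pos 99
        0<h : 0# < h
        0<h = ⁻¹-pos 0<N
        100h≈1 : fromℕ 100 * h ≈ 1#
        100h≈1 = ⁻¹-inverse 0<N
        h≤1 : h ≤ 1#
        h≤1 = x+e≈y⇒x≤y (*-nonneg (fromℕ-nonneg 99) (<⇒≤ 0<h))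
          (trans (solve 1 (λ h → h :+ κ 99 :* h := κ 100 :* h) refl h) 100h≈1)

        0≤1-h : 0# ≤ 1# - h
        0≤1-h = x≤y⇒0≤y-x h≤1
        1-h≤1 : 1# - h ≤ 1#
        1-h≤1 = x+e≈y⇒x≤y (<⇒≤ 0<h) (solve 1 (λ h → κ 1 :- h :+ h := κ 1) refl h)

        -- The two-point bound with c = 1 - h = 99/100 and err ≤ 49h.
        h²≤1-G : h * h ≤ 1# - G
        h²≤1-G = x+e≈y⇒x≤y
          (+-nonneg (+-nonneg (x≤y⇒0≤y-x (two-point 0≤1-h 1-h≤1))
              (*-nonneg (0≤1-c² 0≤1-h 1-h≤1) (x≤y⇒0≤y-x (≤-trans err≤δ (<⇒≤ δ<49/100)))))
            (+-nonneg (*-nonneg (*-nonneg (<⇒≤ 0<h) (<⇒≤ 0<h)) (*-nonneg (fromℕ-nonneg 49) (<⇒≤ 0<h)))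
              (*-nonneg (<⇒≤ 0<h) (x≤y⇒0≤y-x G≤1))))
          (trans (solve 3 (λ h g e →
              h :* h :+ (((κ 1 :- (κ 1 :- h) :* (κ 1 :- h)) :* e :+ (κ 1 :- h) :* (κ 1 :- h) :- (κ
                1 :- h) :* g
                :+ (κ 1 :- (κ 1 :- h) :* (κ 1 :- h)) :* (κ 49 :* h :- e)) :+ (h :* h :* (κ 49 :* h) :+ h :* (κ
                  1 :- g)))
              := κ 1 :- g :+ h :* (κ 100 :* h :- κ 1)) refl h G err)
            (trans (+-congˡ (trans (*-congˡ (trans (+-congʳ 100h≈1) (-‿inverseʳ 1#))) (zeroʳ h)))
              (+-identityʳ _)))

        -- The floor T / K ≥ 10⁻⁴ / (1 - 2p)², valid for every admissible δ. Both terms of the query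
        -- bound rest on it.
        1≤N²τB : 1# ≤ N * N * (τ * B)
        1≤N²τB = begin
          1#                    ≈⟨ trans (*-cong 100h≈1 100h≈1) (*-identityʳ 1#) ⟨
          N * h * (N * h)       ≈⟨ solve 2 (λ n h → n :* h :* (n :* h) := n :* n :* (h :* h)) refl N h ⟩
          N * N * (h * h)       ≤⟨ *-monoˡ-≤ (N * N) (square-nonneg N) (≤-trans h²≤1-G 1-G≤τbias²) ⟩
          N * N * (τ * B)       ∎
          where open ≤R

        Λ : ℝ
        Λ = log (1# / δ)

        -- Solving (1/4) exp(- T D / K) ≤ δ for log(1/δ) leaves an additive log 4, which is at most
        -- 3 because 4 = 1 + 3 ≤ exp 3.
        Λ≤τD+3 : Λ ≤ fromℕ T * D / fromℕ K + fromℕ 3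
        Λ≤τD+3 = exp-cancel-≤ (*-cancelʳ-≤ δ 0<δ (begin
          exp Λ * δ
            ≈⟨ *-congʳ (exp-log (/-pos 0<1 0<δ)) ⟩
          1# / δ * δ
            ≈⟨ x/y*y≈x 0<δ ⟩
          1#
            ≈⟨ trans (*-comm _ _) (x/y*y≈x (fromℕ-pos 3)) ⟨
          fromℕ 4 * (1# / fromℕ 4)
            ≤⟨ *-monoʳ-≤ _ (/-nonneg 0≤1 (fromℕ-pos 3))
              (≤-trans (≈⇒≤ (solve 0 (κ 4 := κ 1 :+ κ 3) refl)) (1+x≤exp (fromℕ 3))) ⟩
          exp (fromℕ 3) * (1# / fromℕ 4)
            ≈⟨ trans (*-congʳ (*-congˡ (exp-neg-* z))) (*-congʳ (*-identityʳ _)) ⟨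
          exp (fromℕ 3) * (exp (- z) * exp z) * (1# / fromℕ 4)
            ≈⟨ solve 4 (λ a b c f → a :* (b :* c) :* f := (c :* a) :* (f :* b)) refl (exp (fromℕ 3))
              (exp (- z)) (exp z) (1# / fromℕ 4) ⟩
          exp z * exp (fromℕ 3) * (1# / fromℕ 4 * exp (- z))
            ≤⟨ *-monoˡ-≤ _ (*-nonneg (<⇒≤ (exp-pos z)) (<⇒≤ (exp-pos (fromℕ 3)))) (≤-trans exp-bound err≤δ) ⟩
          exp z * exp (fromℕ 3) * δ
            ≈⟨ *-congʳ (exp-+ z (fromℕ 3)) ⟨
          exp (z + fromℕ 3) * δ ∎))
          where
          open ≤R
          z : ℝ
          z = fromℕ T * D / fromℕ K

        K*τ≈T : fromℕ K * τ ≈ fromℕ T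
        K*τ≈T = trans (*-comm _ _) (x/y*y≈x 0<K)

        entropy-term : fromℕ K / (1# - H p) ≤ fromℕ 8 * (N * N) * fromℕ T
        entropy-term = x≤z*y⇒x/y≤z (0<1-H 0<p p<½) (begin
          fromℕ K                                             ≈⟨ *-identityʳ _ ⟨
          fromℕ K * 1#                                        ≤⟨ *-monoˡ-≤ _ (<⇒≤ 0<K) 1≤N²τB ⟩
          fromℕ K * (N * N * (τ * B))
            ≤⟨ *-monoˡ-≤ _ (<⇒≤ 0<K) (*-monoˡ-≤ _ (square-nonneg N)
              (*-monoˡ-≤ τ 0≤τ (bias²≤8[1-H] 0<p p<½))) ⟩
          fromℕ K * (N * N * (τ * (fromℕ 8 * (1# - H p))))
            ≈⟨ solve 4 (λ k n t e → k :* (n :* n :* (t :* (κ 8 :* e))) := κ 8 :* (n :* n) :* (k :* t) :* e)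
              refl (fromℕ K) N τ (1# - H p) ⟩
          fromℕ 8 * (N * N) * (fromℕ K * τ) * (1# - H p)      ≈⟨ *-congʳ (*-congˡ K*τ≈T) ⟩
          fromℕ 8 * (N * N) * fromℕ T * (1# - H p)            ∎)
          where open ≤R

        -- The additive 3 is multiplied by N² τ D, which is at least 1 by `1≤N²τB` and `bias²≤KL`;
        -- the whole bound then becomes proportional to T D / K.
        KL-term : fromℕ K * Λ / D ≤ (1# + fromℕ 3 * (N * N)) * fromℕ T
        KL-term = x≤z*y⇒x/y≤z (0<KL 0<p p<½) (begin
          fromℕ K * Λ
            ≤⟨ *-monoˡ-≤ _ (<⇒≤ 0<K) (≤-trans Λ≤τD+3
              (+-mono-≤ ≤-refl (≤-trans (≈⇒≤ (sym (*-identityʳ (fromℕ 3))))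
                 (*-monoˡ-≤ _ (fromℕ-nonneg 3)
                   (≤-trans 1≤N²τB (*-monoˡ-≤ _ (square-nonneg N) (*-monoˡ-≤ τ 0≤τ (bias²≤KL 0<p p<½)))))))) ⟩
          fromℕ K * (fromℕ T * D / fromℕ K + fromℕ 3 * (N * N * (τ * D)))
            ≈⟨ solve 5 (λ k t d r n → k :* (t :* d :* r :+ κ 3 :* (n :* n :* (t :* r :* d))) :=
                 (κ 1 :+ κ 3 :* (n :* n)) :* (k :* (t :* r)) :* d) refl (fromℕ K) (fromℕ T) D (fromℕ K ⁻¹) N ⟩
          (1# + fromℕ 3 * (N * N)) * (fromℕ K * τ) * D
            ≈⟨ *-congʳ (*-congˡ K*τ≈T) ⟩
          (1# + fromℕ 3 * (N * N)) * fromℕ T * D ∎)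
          where open ≤R

      query-bound : fromℕ K / (1# - H p) + fromℕ K * log (1# / δ) / KL p ≤
                    fromℕ T * queryConstant
      query-bound = ≤-trans (+-mono-≤ entropy-term KL-term) (≈⇒≤
        (solve 2 (λ n t → κ 8 :* (n :* n) :* t :+ (κ 1 :+ κ 3 :* (n :* n)) :* t
          := t :* (κ 1 :+ κ 11 :* (n :* n))) refl N (fromℕ T)))

  minimax-bound : ∀ {K} T → 1 ℕ.≤ K → ∀ {p} → 0# < p → p < 1# / fromℕ 2 → (xs : Vec ℝ K) → Increasing xs →
    1# / fromℕ 4 * exp (- (fromℕ T * KL p / fromℕ K)) ≤ minimaxError T p xs
  minimax-bound T 1≤K {p} 0<p p<½ xs inc = sup-≥ _
    -- The infimum is a supremum of lower bounds, and the error of the concrete algorithm `A₀`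
    -- bounds all of these from above.
    (λ k → k (worstError p xs A₀ , λ y lower → lower _ (A₀ , refl)))
    (λ k → k λ { w (A , w≈) → ≤-trans (exp-bound 1≤K 0<p p<½ xs inc A) (≈⇒≤ (sym w≈)) })
    where
    A₀ : NonAdaptive _ T
    A₀ = nonAdaptive T 1≤K

mainTheorem6 : (R : CompleteOrderedField) →
  let open CompleteOrderedField R renaming (Carrier to ℝ)
      open Analysis R
      open NoisySearch R
  in
    (∀ (K T : ℕ) → 1 ≤ᴺ K →
     ∀ (p : ℝ) → 0# < p → p < 1# / fromℕ 2 →
     ∀ (xs : Vec ℝ K) → Increasing xs →
     1# / fromℕ 4 * exp (- (fromℕ T * KL p / fromℕ K)) ≤ minimaxError T p xs)
    ×
    (Σ[ c ∈ ℝ ] 0# < c ×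
      (∀ (K T : ℕ) → 1 ≤ᴺ K →
       ∀ (p : ℝ) → 0# < p → p < 1# / fromℕ 2 →
       ∀ (δ : ℝ) → 0# < δ → δ < fromℕ 49 / fromℕ 100 →
       ∀ (xs : Vec ℝ K) → Increasing xs →
       ∀ (A : NonAdaptive K T) → worstError p xs A ≤ δ →
       c * (fromℕ K / (1# - H p) + fromℕ K * log (1# / δ) / KL p) ≤ fromℕ T))
mainTheorem6 R =
  (λ K T 1≤K p 0<p p<½ xs inc → minimax-bound T 1≤K 0<p p<½ xs inc) ,
  queryConstant ⁻¹ , ⁻¹-pos 0<queryConstant ,
  λ K T 1≤K p 0<p p<½ δ 0<δ δ<49/100 xs inc A err≤δ → ≤-trans (≈⇒≤ (*-comm _ _))
    (x≤z*y⇒x/y≤z 0<queryConstant (query-bound 1≤K 0<p p<½ xs inc A 0<δ δ<49/100 err≤δ))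
  where
  open CompleteOrderedField R using (_⁻¹; commutativeRing)
  open CommutativeRing commutativeRing using (*-comm)
  open LowerBounds R
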